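{- Let $n$ and $\delta$ be nonnegative integers with $\delta \leq n/2$. For every integer $t \geq 3$, every $n$-vertex graph $G$ with minimum degree at least $\delta$ satisfies $i_t(G) \leq i_t(K_{\delta, n-\delta})$. Moreover, when $t \leq \delta$, the complete bipartite graph $K_{\delta, n-\delta}$ is the unique extremal graph, i.e., any $n$-vertex graph $G$ with minimum degree at least $\delta$ and $i_t(G) = i_t(K_{\delta,n-\delta})$ is isomorphic to $K_{\delta,n-\delta}$.
   Context: All graphs are finite and simple. For a graph $G$, $i_t(G)$ denotes the number of independent sets of size $t$ in $G$. $K_{\delta, n-\delta}$ is the complete bipartite graph with parts of sizes $\delta$ and $n-\delta$. -}

module Defs where

open import Data.Nat using (ℕ; zero; suc; _≤_; _+_)
open import Data.Bool using (Bool; true; false; _∧_; not; if_then_else_)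
open import Data.Fin using (Fin; toℕ)
open import Data.List using (List; []; _∷_; map; _++_; length; allFin)
open import Data.Vec using (Vec; []; _∷_; lookup)
open import Data.Fin.Subset using (Subset; ∣_∣; _∈_; inside; outside)
open import Relation.Binary.PropositionalEquality using (_≡_)
open import Relation.Nullary using (¬_)
open import Relation.Nullary.Decidable using (does)
open import Data.Nat using (_≟_; _<ᵇ_)
open import Function using (_∘_)
open import Data.Product using (Σ; _×_)

record Graph (n : ℕ) : Set where
  field
    adj   : Fin n → Fin n → Bool
    sym   : ∀ u v → adj u v ≡ adj v u
    irrefl : ∀ v → adj v v ≡ false
open Graph public

countᵇ : ∀ {A : Set} → (A → Bool) → List A → ℕ
countᵇ p [] = 0
countᵇ p (x ∷ xs) = if p x then suc (countᵇ p xs) else countᵇ p xs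

degree : ∀ {n} → Graph n → Fin n → ℕ
degree {n} G v = countᵇ (λ u → adj G v u) (allFin n)

MinDegreeAtLeast : ∀ {n} → Graph n → ℕ → Set
MinDegreeAtLeast G δ = ∀ v → δ ≤ degree G v

allSubsets : (n : ℕ) → List (Subset n)
allSubsets zero = [] ∷ []
allSubsets (suc n) = map (outside ∷_) (allSubsets n) ++ map (inside ∷_) (allSubsets n)

isIndependentᵇ : ∀ {n} → Graph n → Subset n → Bool
isIndependentᵇ {n} G S = allᵇ (λ u → allᵇ (λ v → not (lookup S u ∧ lookup S v ∧ adj G u v)) (allFin n)) (allFin n)
  where
    allᵇ : ∀ {A : Set} → (A → Bool) → List A → Bool
    allᵇ p [] = true
    allᵇ p (x ∷ xs) = p x ∧ allᵇ p xs

indepCount : ∀ {n} → ℕ → Graph n → ℕ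
indepCount {n} t G = countᵇ (λ S → isIndependentᵇ G S ∧ (∣ S ∣ ≡ᵇ t)) (allSubsets n)
  where
    open import Data.Nat using (_≡ᵇ_)

completeBipartite : (n δ : ℕ) → Graph n
completeBipartite n δ = record { adj = a ; sym = s ; irrefl = i }
  where
    side : Fin n → Bool
    side v = toℕ v <ᵇ δ
    xor : Bool → Bool → Bool
    xor true b = not b
    xor false b = b
    a : Fin n → Fin n → Bool
    a u v = xor (side u) (side v)
    s : ∀ u v → a u v ≡ a v u
    s u v with side u | side v
    ... | true | true = Relation.Binary.PropositionalEquality.refl
    ... | true | false = Relation.Binary.PropositionalEquality.refl
    ... | false | true = Relation.Binary.PropositionalEquality.refl
    ... | false | false = Relation.Binary.PropositionalEquality.refl
    i : ∀ v → a v v ≡ false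
    i v with side v
    ... | true = Relation.Binary.PropositionalEquality.refl
    ... | false = Relation.Binary.PropositionalEquality.refl

record _≅_ {n : ℕ} (G H : Graph n) : Set where
  field
    f     : Fin n → Fin n
    g     : Fin n → Fin n
    fg    : ∀ v → f (g v) ≡ v
    gf    : ∀ v → g (f v) ≡ v
    preserves : ∀ u v → adj H (f u) (f v) ≡ adj G u v

{-# OPTIONS --safe #-}

-- For a vertex v of W, the independent t-subsets of W either lie inside N(v) or "escape" it.
-- Averaging over v ∈ W, the number of escaping sets is at most the number of t-subsets of
-- W ∖ N(v): sets through v are compared one by one, and sets S avoiding v are grouped by
-- U = S ∪ {v}, where the comparison is an inequality about the (t+1)-set U alone.  So some
-- v ∈ W has at most C(|W ∖ N(v)|, t) escaping sets.  With D = n − δ we have |W ∖ N(v)| ≤ D, and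
-- induction on N(v) ∩ W together with convexity of m ↦ C(m, t) bounds the number of
-- independent t-subsets of W by C(D, t) + C(|W| − D, t).
-- If the bound is attained for W = V and t ≤ δ, every inequality is tight for every v; then
-- N(v) and V ∖ N(v) are independent of sizes δ and D in some order, and G is complete bipartite.
module Submission where

open import Defs hiding (sym)
open import Data.Nat.Properties
open import Algebra.Properties.CommutativeSemigroup +-commutativeSemigroup using (interchange)
open import Algebra.Properties.CommutativeMonoid.Sum +-0-commutativeMonoid
  using (sum; sum-cong-≗; ∑-distrib-+)
open import Data.Bool using (Bool; true; false; not; _∧_; _xor_; T)
open import Data.Bool.ListAction using (all)
import Data.Bool.Properties as Bool
open import Data.Empty using (⊥; ⊥-elim)
open import Data.Fin as Fin using (Fin; zero; suc; toℕ; fromℕ)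
open import Data.Fin.Permutation as Perm using (Permutation′; _⟨$⟩ʳ_; _⟨$⟩ˡ_; inverseˡ; inverseʳ)
import Data.Fin.Properties as Fin
open import Data.Fin.Subset as Subset
  using (Subset; inside; outside; ∣_∣; _∈_; _∉_; _⊆_; _∩_; _∪_; _─_; _-_; ⁅_⁆; ⊤)
open import Data.Fin.Subset.Properties
open import Data.List as List using (List; []; _∷_; allFin; map; _++_)
import Data.List.Membership.Propositional as List
open import Data.List.Membership.Propositional.Properties using (∈-allFin)
open import Data.List.Relation.Unary.Any using (here; there)
open import Data.Nat hiding (∣_-_∣)
open import Data.Nat.Combinatorics using (_C_; nCk+nC[k+1]≡[n+1]C[k+1]; k>n⇒nCk≡0)
open import Data.Nat.Induction using (<-wellFounded; Acc; acc)
open import Data.Product using (∃; _×_; _,_; proj₁; proj₂)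
open import Data.Sum using (_⊎_; inj₁; inj₂)
open import Data.Vec using ([]; _∷_; lookup; tabulate; here; there)
open import Data.Vec.Properties using (lookup⇒[]=; []=⇒lookup; lookup∘tabulate)
open import Function using (_∘_; case_of_; Equivalence)
open import Relation.Binary.PropositionalEquality hiding ([_])
open import Relation.Nullary using (¬_; Dec; yes; no; contradiction)
open import Relation.Nullary.Decidable using (map′; _×-dec_; ¬?)

-- Indicators of decidable propositions.

private
  variable
    P Q R : Set

𝟙 : Dec P → ℕ
𝟙 (yes _) = 1
𝟙 (no _) = 0

𝟙-× : (p : Dec P) (q : Dec Q) → 𝟙 p * 𝟙 q ≡ 𝟙 (p ×-dec q)
𝟙-× (no _) q = refl
𝟙-× (yes _) (yes _) = refl
𝟙-× (yes _) (no _) = refl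

𝟙≤1 : (p : Dec P) → 𝟙 p ≤ 1
𝟙≤1 (yes _) = ≤-refl
𝟙≤1 (no _) = z≤n

𝟙-yes : (p : Dec P) → P → 𝟙 p ≡ 1
𝟙-yes (yes _) _ = refl
𝟙-yes (no ¬p) p = contradiction p ¬p

𝟙-no : (p : Dec P) → ¬ P → 𝟙 p ≡ 0
𝟙-no (yes p) ¬p = contradiction p ¬p
𝟙-no (no _) _ = refl

𝟙-zero : (p : Dec P) → 𝟙 p ≤ 0 → ¬ P
𝟙-zero (no ¬p) _ = ¬p

𝟙-mono : (p : Dec P) (q : Dec Q) → (P → Q) → 𝟙 p ≤ 𝟙 q
𝟙-mono (no _) q f = z≤n
𝟙-mono (yes p) q f = ≤-reflexive (sym (𝟙-yes q (f p)))

𝟙-cong : (p : Dec P) (q : Dec Q) → (P → Q) → (Q → P) → 𝟙 p ≡ 𝟙 q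
𝟙-cong p q f g = ≤-antisym (𝟙-mono p q f) (𝟙-mono q p g)

𝟙-cover : (p : Dec P) (q : Dec Q) (r : Dec R) → (P → Q ⊎ R) → 𝟙 p ≤ 𝟙 q + 𝟙 r
𝟙-cover (no _) q r f = z≤n
𝟙-cover (yes p) q r f with f p
... | inj₁ x = ≤-trans (≤-reflexive (sym (𝟙-yes q x))) (m≤m+n _ _)
... | inj₂ y = ≤-trans (≤-reflexive (sym (𝟙-yes r y))) (m≤n+m _ _)

𝟙-disjoint : (p : Dec P) (q : Dec Q) (r : Dec R) →
  (Q → P) → (R → P) → (Q → ¬ R) → 𝟙 q + 𝟙 r ≤ 𝟙 p
𝟙-disjoint p (yes x) r f g h = ≤-reflexive (trans (cong suc (𝟙-no r (h x))) (sym (𝟙-yes p (f x))))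
𝟙-disjoint p (no _) r f g h = 𝟙-mono r p g

-- Sums over vertices and the propagation of equality to their terms.

+-boundˡ : ∀ {a b c d} → a + b ≤ c + d → d ≤ b → a ≤ c
+-boundˡ {a} {b} {c} {d} h d≤b = +-cancelʳ-≤ d a c (≤-trans (+-monoʳ-≤ a d≤b) h)

+-boundʳ : ∀ {a b c d} → a + b ≤ c + d → c ≤ a → b ≤ d
+-boundʳ {a} {b} {c} {d} h c≤a = +-cancelˡ-≤ c b d (≤-trans (+-monoˡ-≤ b c≤a) h)

sum-mono : ∀ {n} {f g : Fin n → ℕ} → (∀ i → f i ≤ g i) → sum f ≤ sum g
sum-mono {zero} f≤g = z≤n
sum-mono {suc n} f≤g = +-mono-≤ (f≤g zero) (sum-mono (f≤g ∘ suc))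

-- The remaining terms are compared in the same direction, so they cancel and leave no slack in any
-- single term. This turns an attained bound into equality at every vertex.
sum-mono-tight : ∀ {n} {f g : Fin n → ℕ} → (∀ i → f i ≤ g i) → sum g ≤ sum f → ∀ i → g i ≤ f i
sum-mono-tight f≤g h zero = +-boundˡ h (sum-mono (f≤g ∘ suc))
sum-mono-tight f≤g h (suc i) = sum-mono-tight (f≤g ∘ suc) (+-boundʳ h (f≤g zero)) i

sum-𝟙≟ : ∀ {n} (v : Fin n) → sum (λ u → 𝟙 (u Fin.≟ v)) ≡ 1
sum-𝟙≟ {suc n} zero = cong suc (trans (sum-cong-≗ {n} (λ u → 𝟙-no (suc u Fin.≟ zero) λ ())) (zeros n))
  where
  zeros : ∀ n → sum {n} (λ _ → 0) ≡ 0
  zeros zero = refl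
  zeros (suc n) = zeros n
sum-𝟙≟ {suc n} (suc v) = trans (sum-cong-≗ {n} λ u →
  𝟙-cong (suc u Fin.≟ suc v) (u Fin.≟ v) Fin.suc-injective (cong suc)) (sum-𝟙≟ v)

∣∣≡sum : ∀ {n} (U : Subset n) → ∣ U ∣ ≡ sum (λ u → 𝟙 (u ∈? U))
∣∣≡sum [] = refl
∣∣≡sum (inside ∷ U) = cong suc (trans (∣∣≡sum U) (sum-cong-≗ λ u →
  𝟙-cong (u ∈? U) (suc u ∈? inside ∷ U) there drop-there))
∣∣≡sum (outside ∷ U) = trans (∣∣≡sum U) (sum-cong-≗ λ u →
  𝟙-cong (u ∈? U) (suc u ∈? outside ∷ U) there drop-there)

-- Sums over all vertex sets.

-- Recursion on the first membership bit, in the order of `allSubsets`, so that counting along that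
-- list becomes a sum of indicators.
∑ : ∀ {n} → (Subset n → ℕ) → ℕ
∑ {zero} f = f []
∑ {suc n} f = ∑ (f ∘ (outside ∷_)) + ∑ (f ∘ (inside ∷_))

∑-cong : ∀ {n} {f g : Subset n → ℕ} → (∀ S → f S ≡ g S) → ∑ f ≡ ∑ g
∑-cong {zero} eq = eq []
∑-cong {suc n} eq = cong₂ _+_ (∑-cong (eq ∘ (outside ∷_))) (∑-cong (eq ∘ (inside ∷_)))

∑-mono : ∀ {n} {f g : Subset n → ℕ} → (∀ S → f S ≤ g S) → ∑ f ≤ ∑ g
∑-mono {zero} f≤g = f≤g []
∑-mono {suc n} f≤g = +-mono-≤ (∑-mono (f≤g ∘ (outside ∷_))) (∑-mono (f≤g ∘ (inside ∷_)))

∑-mono-tight : ∀ {n} {f g : Subset n → ℕ} → (∀ S → f S ≤ g S) → ∑ g ≤ ∑ f → ∀ S → g S ≤ f S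
∑-mono-tight f≤g h [] = h
∑-mono-tight f≤g h (outside ∷ S) =
  ∑-mono-tight (f≤g ∘ (outside ∷_)) (+-boundˡ h (∑-mono (f≤g ∘ (inside ∷_)))) S
∑-mono-tight f≤g h (inside ∷ S) =
  ∑-mono-tight (f≤g ∘ (inside ∷_)) (+-boundʳ h (∑-mono (f≤g ∘ (outside ∷_)))) S

∑-zero : ∀ n → ∑ {n} (λ _ → 0) ≡ 0
∑-zero zero = refl
∑-zero (suc n) = cong₂ _+_ (∑-zero n) (∑-zero n)

∑-distrib : ∀ {n} (f g : Subset n → ℕ) → ∑ (λ S → f S + g S) ≡ ∑ f + ∑ g
∑-distrib {zero} f g = refl
∑-distrib {suc n} f g = trans
  (cong₂ _+_ (∑-distrib (f ∘ (outside ∷_)) (g ∘ (outside ∷_))) (∑-distrib (f ∘ (inside ∷_)) (g ∘ (inside ∷_))))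
  (interchange (∑ (f ∘ (outside ∷_))) (∑ (g ∘ (outside ∷_))) (∑ (f ∘ (inside ∷_))) (∑ (g ∘ (inside ∷_))))

∑-sum-comm : ∀ {m n} (f : Fin m → Subset n → ℕ) → sum (λ v → ∑ (f v)) ≡ ∑ (λ S → sum (λ v → f v S))
∑-sum-comm {n = zero} f = refl
∑-sum-comm {m} {suc n} f = trans (∑-distrib-+ {m} _ _)
  (cong₂ _+_ (∑-sum-comm (λ v → f v ∘ (outside ∷_))) (∑-sum-comm (λ v → f v ∘ (inside ∷_))))

-- Reindexing along the bijection between sets S avoiding v and sets U containing v, given by S =
-- `U - v`. It is what groups the sets avoiding v by U.
∑-remove : ∀ {n} (v : Fin n) (h : Subset n → ℕ) →
  ∑ (λ S → 𝟙 (¬? (v ∈? S)) * h S) ≡ ∑ (λ U → 𝟙 (v ∈? U) * h (U - v))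
∑-remove {suc n} zero h = begin
  ∑ (λ S → 1 * h (outside ∷ S)) + ∑ {n} (λ S → 0)
    -- The halves trade places: sets without vertex 0 form the `outside` half, sets with it the
    -- `inside` half.
    ≡⟨ +-comm _ (∑ {n} (λ S → 0)) ⟩
  ∑ {n} (λ S → 0) + ∑ (λ S → 1 * h (outside ∷ S))
    ≡⟨ cong (∑ {n} (λ S → 0) +_) (∑-cong λ S → cong (λ U → 1 * h (outside ∷ U)) (sym (p─⊥≡p S))) ⟩
  ∑ {n} (λ S → 0) + ∑ (λ S → 1 * h (outside ∷ (S ─ Subset.⊥))) ∎
  where open ≡-Reasoning
∑-remove {suc n} (suc v) h = cong₂ _+_ (half outside) (half inside)
  where
  open ≡-Reasoning
  half : ∀ s → ∑ (λ S → 𝟙 (¬? (suc v ∈? s ∷ S)) * h (s ∷ S)) ≡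
    ∑ (λ U → 𝟙 (suc v ∈? s ∷ U) * h ((s ∷ U) - suc v))
  half s = begin
    ∑ (λ S → 𝟙 (¬? (suc v ∈? s ∷ S)) * h (s ∷ S))
      ≡⟨ ∑-cong (λ S → cong (_* h (s ∷ S))
        (𝟙-cong (¬? (suc v ∈? s ∷ S)) (¬? (v ∈? S)) (_∘ there) (_∘ drop-there))) ⟩
    ∑ (λ S → 𝟙 (¬? (v ∈? S)) * h (s ∷ S))
      ≡⟨ ∑-remove v (h ∘ (s ∷_)) ⟩
    ∑ (λ U → 𝟙 (v ∈? U) * h (s ∷ (U - v)))
      ≡⟨ ∑-cong (λ U → cong (_* h (s ∷ (U - v))) (𝟙-cong (v ∈? U) (suc v ∈? s ∷ U) there drop-there)) ⟩
    ∑ (λ U → 𝟙 (suc v ∈? s ∷ U) * h (s ∷ (U - v))) ∎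

-- The independence test as a nested `all`.

-- The two defining equations determine a list quantifier, so one that is accessible only through
-- its values can still be identified with `all`.
all-unique : ∀ {X : Set} (a : (X → Bool) → List X → Bool) →
  (∀ p → a p [] ≡ true) → (∀ p x xs → a p (x ∷ xs) ≡ p x ∧ a p xs) →
  ∀ p xs → a p xs ≡ all p xs
all-unique a nil cons p [] = nil p
all-unique a nil cons p (x ∷ xs) = trans (cons p x xs) (cong (p x ∧_) (all-unique a nil cons p xs))

all-cong : ∀ {X : Set} {p q : X → Bool} → (∀ x → p x ≡ q x) → ∀ xs → all p xs ≡ all q xs
all-cong eq [] = refl
all-cong eq (x ∷ xs) = cong₂ _∧_ (eq x) (all-cong eq xs)

-- The list quantifier inside isIndependentᵇ is local to its definition and cannot be named.  Once
-- the list, lookup S, adj G and not are abstracted to variables, unification solves `pairs` and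
-- then `row`, and instantiating `row` gives the quantifier back for an arbitrary predicate.
module _ {n} (G : Graph n) (S : Subset n) where
  mutual
    pairs : (Bool → Bool) → (Fin n → Bool) → (Fin n → Fin n → Bool) → List (Fin n) → Bool
    pairs N s a xs = _

    indep≡pairs : isIndependentᵇ G S ≡ pairs not (lookup S) (adj G) (allFin n)
    indep≡pairs with allFin n | lookup S | adj G | not
    ... | xs | s | a | N = refl

  mutual
    row : (Bool → Bool) → (Fin n → Bool) → (Fin n → Fin n → Bool) → Fin n → List (Fin n) → Bool
    row N s a x xs = _

    pairs∷ : ∀ N s a x xs → pairs N s a (x ∷ xs) ≡ (N (s x ∧ (s x ∧ a x x)) ∧ row N s a x xs) ∧ _
    pairs∷ N s a x xs = refl

  recoveredAll : (Fin n → Bool) → Fin n → List (Fin n) → Bool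
  recoveredAll p = row (λ b → b) (λ _ → true) (λ _ → p)

  pairs≡ : ∀ N s a xs → pairs N s a xs ≡ all (λ u → all (λ v → N (s u ∧ (s v ∧ a u v))) xs) xs
  pairs≡ N s a [] = refl
  -- `recoveredAll` requires some vertex as argument, and the head `x` supplies it. The outer
  -- quantifier is replaced first, then the inner one.
  pairs≡ N s a (x ∷ xs) = trans
    (h (λ u → recoveredAll (f u) x (x ∷ xs)) (x ∷ xs))
    (all-cong (λ u → h (f u) (x ∷ xs)) (x ∷ xs))
    where
    f = λ u v → N (s u ∧ (s v ∧ a u v))
    h = all-unique (λ p → recoveredAll p x) (λ _ → refl) (λ _ _ _ → refl)

  isIndependentᵇ≡ : isIndependentᵇ G S ≡
    all (λ u → all (λ v → not (lookup S u ∧ (lookup S v ∧ adj G u v))) (allFin n)) (allFin n)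
  isIndependentᵇ≡ = trans indep≡pairs (pairs≡ not (lookup S) (adj G) (allFin n))

-- Cardinalities of finite sets.

x∈p─q⇒x∉q : ∀ {n} {x : Fin n} (p q : Subset n) → x ∈ p ─ q → x ∉ q
x∈p─q⇒x∉q (_ ∷ p) (outside ∷ q) (there x∈p─q) (there x∈q) = x∈p─q⇒x∉q p q x∈p─q x∈q
x∈p─q⇒x∉q (_ ∷ p) (inside ∷ q) (there x∈p─q) (there x∈q) = x∈p─q⇒x∉q p q x∈p─q x∈q

─-monoˡ : ∀ {n} {p q : Subset n} (r : Subset n) → p ⊆ q → p ─ r ⊆ q ─ r
─-monoˡ {p = p} r p⊆q x∈ = x∈p∧x∉q⇒x∈p─q (p⊆q (p─q⊆p p r x∈)) (x∈p─q⇒x∉q p r x∈)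

∣p∩q∣+∣p─q∣≡∣p∣ : ∀ {n} (p q : Subset n) → ∣ p ∩ q ∣ + ∣ p ─ q ∣ ≡ ∣ p ∣
∣p∩q∣+∣p─q∣≡∣p∣ [] [] = refl
∣p∩q∣+∣p─q∣≡∣p∣ (outside ∷ p) (outside ∷ q) = ∣p∩q∣+∣p─q∣≡∣p∣ p q
∣p∩q∣+∣p─q∣≡∣p∣ (outside ∷ p) (inside ∷ q) = ∣p∩q∣+∣p─q∣≡∣p∣ p q
∣p∩q∣+∣p─q∣≡∣p∣ (inside ∷ p) (outside ∷ q) = trans (+-suc _ _) (cong suc (∣p∩q∣+∣p─q∣≡∣p∣ p q))
∣p∩q∣+∣p─q∣≡∣p∣ (inside ∷ p) (inside ∷ q) = cong suc (∣p∩q∣+∣p─q∣≡∣p∣ p q)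

∣p∣+∣⊤─p∣≡n : ∀ {n} (p : Subset n) → ∣ p ∣ + ∣ ⊤ ─ p ∣ ≡ n
∣p∣+∣⊤─p∣≡n {n} p = trans (cong (λ q → ∣ q ∣ + ∣ ⊤ ─ p ∣) (sym (∩-identityˡ p)))
  (trans (∣p∩q∣+∣p─q∣≡∣p∣ ⊤ p) (∣⊤∣≡n n))

∣p∪q∣≤∣p∣+∣q∣ : ∀ {n} (p q : Subset n) → ∣ p ∪ q ∣ ≤ ∣ p ∣ + ∣ q ∣
∣p∪q∣≤∣p∣+∣q∣ [] [] = z≤n
∣p∪q∣≤∣p∣+∣q∣ (outside ∷ p) (outside ∷ q) = ∣p∪q∣≤∣p∣+∣q∣ p q
∣p∪q∣≤∣p∣+∣q∣ (outside ∷ p) (inside ∷ q) = ≤-trans (s≤s (∣p∪q∣≤∣p∣+∣q∣ p q)) (≤-reflexive (sym (+-suc _ _)))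
∣p∪q∣≤∣p∣+∣q∣ (inside ∷ p) (outside ∷ q) = s≤s (∣p∪q∣≤∣p∣+∣q∣ p q)
∣p∪q∣≤∣p∣+∣q∣ (inside ∷ p) (inside ∷ q) = s≤s (≤-trans (∣p∪q∣≤∣p∣+∣q∣ p q) (+-monoʳ-≤ ∣ p ∣ (n≤1+n _)))

⁅x⁆⊆ : ∀ {n} {x : Fin n} {p : Subset n} → x ∈ p → ⁅ x ⁆ ⊆ p
⁅x⁆⊆ {x = x} x∈p y∈ rewrite x∈⁅y⁆⇒x≡y x y∈ = x∈p

⁅x⁆∪p⊆ : ∀ {n} {x : Fin n} {p q : Subset n} → x ∈ q → p ⊆ q → ⁅ x ⁆ ∪ p ⊆ q
⁅x⁆∪p⊆ {x = x} {p} x∈q p⊆q y∈ with x∈p∪q⁻ ⁅ x ⁆ p y∈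
... | inj₁ y∈x = ⁅x⁆⊆ x∈q y∈x
... | inj₂ y∈p = p⊆q y∈p

∣⁅x⁆∪p∣≤ : ∀ {n} (x : Fin n) (p : Subset n) → ∣ ⁅ x ⁆ ∪ p ∣ ≤ suc ∣ p ∣
∣⁅x⁆∪p∣≤ x p = ≤-trans (∣p∪q∣≤∣p∣+∣q∣ ⁅ x ⁆ p) (≤-reflexive (cong (_+ ∣ p ∣) (∣⁅x⁆∣≡1 x)))

∣⁅x⁆∪⁅y⁆∣≤2 : ∀ {n} (x y : Fin n) → ∣ ⁅ x ⁆ ∪ ⁅ y ⁆ ∣ ≤ 2
∣⁅x⁆∪⁅y⁆∣≤2 x y = ≤-trans (∣⁅x⁆∪p∣≤ x ⁅ y ⁆) (s≤s (≤-reflexive (∣⁅x⁆∣≡1 y)))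

suc∣p-x∣≡∣p∣ : ∀ {n} {x : Fin n} {p : Subset n} → x ∈ p → suc ∣ p - x ∣ ≡ ∣ p ∣
suc∣p-x∣≡∣p∣ {p = inside ∷ p} here = cong (suc ∘ ∣_∣) (p─⊥≡p p)
suc∣p-x∣≡∣p∣ {p = inside ∷ p} (there x∈p) = cong suc (suc∣p-x∣≡∣p∣ x∈p)
suc∣p-x∣≡∣p∣ {p = outside ∷ p} (there x∈p) = suc∣p-x∣≡∣p∣ x∈p

∣p∣>0⇒Nonempty : ∀ {n} (p : Subset n) → 0 < ∣ p ∣ → ∃ (_∈ p)
∣p∣>0⇒Nonempty (inside ∷ p) _ = zero , here
∣p∣>0⇒Nonempty (outside ∷ p) 0<∣p∣ with ∣p∣>0⇒Nonempty p 0<∣p∣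
... | x , x∈p = suc x , there x∈p

-- Pads a small set to exactly `t` elements, so that what is known about t-subsets reaches pairs and
-- triples of vertices.
between : ∀ {n} {S W : Subset n} {t} → S ⊆ W → ∣ S ∣ ≤ t → t ≤ ∣ W ∣ →
  ∃ λ T → S ⊆ T × T ⊆ W × ∣ T ∣ ≡ t
between {S = []} {[]} S⊆W _ t≤ = [] , S⊆W , (λ ()) , sym (n≤0⇒n≡0 t≤)
between {S = inside ∷ S} {outside ∷ W} S⊆W _ _ with () ← S⊆W here
between {S = inside ∷ S} {inside ∷ W} S⊆W (s≤s ≤t) (s≤s t≤) with between (drop-∷-⊆ S⊆W) ≤t t≤
... | T , S⊆T , T⊆W , ∣T∣≡t = inside ∷ T , s⊆s S⊆T , s⊆s T⊆W , cong suc ∣T∣≡t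
between {S = outside ∷ S} {outside ∷ W} S⊆W ≤t t≤ with between (drop-∷-⊆ S⊆W) ≤t t≤
... | T , S⊆T , T⊆W , ∣T∣≡t = outside ∷ T , s⊆s S⊆T , s⊆s T⊆W , ∣T∣≡t
between {S = outside ∷ S} {inside ∷ W} {t} S⊆W ≤t t≤ with t ≤? ∣ W ∣
-- Skipping this element would leave fewer than `t` in the rest of W, so all of W has to be taken.
... | no t≰ = inside ∷ W , S⊆W , (λ x∈ → x∈) , ≤-antisym (≰⇒> t≰) t≤
... | yes t≤∣W∣ with between (drop-∷-⊆ S⊆W) ≤t t≤∣W∣
... | T , S⊆T , T⊆W , ∣T∣≡t = outside ∷ T , s⊆s S⊆T , out⊆ T⊆W , ∣T∣≡t

-- Binomial coefficients and their convexity.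

nC0≡1 : ∀ n → n C 0 ≡ 1
nC0≡1 zero = refl
nC0≡1 (suc n) = refl

sized⊆? : ∀ {n} t (W S : Subset n) → Dec (∣ S ∣ ≡ t × S ⊆ W)
sized⊆? t W S = (∣ S ∣ ≟ t) ×-dec (S ⊆? W)

-- Pascal's rule, splitting on whether the first element of W is chosen.
∑-subsets≡C : ∀ {n} (W : Subset n) t → ∑ (λ S → 𝟙 (sized⊆? t W S)) ≡ ∣ W ∣ C t
∑-subsets≡C [] zero = refl
∑-subsets≡C [] (suc t) = sym (k>n⇒nCk≡0 {0} {suc t} (s≤s z≤n))
∑-subsets≡C {suc n} (outside ∷ W) t = begin
  ∑ (λ S → 𝟙 (sized⊆? t (outside ∷ W) (outside ∷ S))) +
  ∑ (λ S → 𝟙 (sized⊆? t (outside ∷ W) (inside ∷ S)))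
    ≡⟨ cong₂ _+_
      (∑-cong λ S → 𝟙-cong _ (sized⊆? t W S) (λ (e , s) → e , drop-∷-⊆ s) (λ (e , s) → e , s⊆s s))
      (trans (∑-cong λ S → 𝟙-no (sized⊆? t (outside ∷ W) (inside ∷ S)) λ (_ , s) →
        contradiction (s here) λ ()) (∑-zero n)) ⟩
  ∑ (λ S → 𝟙 (sized⊆? t W S)) + 0
    ≡⟨ +-identityʳ _ ⟩
  ∑ (λ S → 𝟙 (sized⊆? t W S))
    ≡⟨ ∑-subsets≡C W t ⟩
  ∣ W ∣ C t ∎
  where open ≡-Reasoning
∑-subsets≡C {suc n} (inside ∷ W) t = begin
  ∑ (λ S → 𝟙 (sized⊆? t (inside ∷ W) (outside ∷ S))) + with-inside t
    ≡⟨ cong (_+ with-inside t)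
      (∑-cong λ S → 𝟙-cong _ (sized⊆? t W S) (λ (e , s) → e , drop-∷-⊆ s) (λ (e , s) → e , out⊆ s)) ⟩
  ∑ (λ S → 𝟙 (sized⊆? t W S)) + with-inside t
    ≡⟨ cong (_+ with-inside t) (∑-subsets≡C W t) ⟩
  ∣ W ∣ C t + with-inside t
    ≡⟨ pascal t ⟩
  suc ∣ W ∣ C t ∎
  where
  open ≡-Reasoning
  with-inside : ℕ → ℕ
  with-inside t = ∑ (λ S → 𝟙 (sized⊆? t (inside ∷ W) (inside ∷ S)))
  pascal : ∀ t → ∣ W ∣ C t + with-inside t ≡ suc ∣ W ∣ C t
  pascal zero = begin
    ∣ W ∣ C 0 + with-inside 0
      ≡⟨ cong₂ _+_ (nC0≡1 ∣ W ∣)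
        (trans (∑-cong λ S → 𝟙-no (sized⊆? 0 (inside ∷ W) (inside ∷ S)) λ ()) (∑-zero n)) ⟩
    1 ∎
  pascal (suc t) = begin
    ∣ W ∣ C suc t + with-inside (suc t)
      ≡⟨ +-comm (∣ W ∣ C suc t) (with-inside (suc t)) ⟩
    with-inside (suc t) + ∣ W ∣ C suc t
      ≡⟨ cong (_+ ∣ W ∣ C suc t) (∑-cong λ S → 𝟙-cong _ (sized⊆? t W S)
        (λ (e , s) → suc-injective e , drop-∷-⊆ s) (λ (e , s) → cong suc e , s⊆s s)) ⟩
    ∑ (λ S → 𝟙 (sized⊆? t W S)) + ∣ W ∣ C suc t
      ≡⟨ cong (_+ ∣ W ∣ C suc t) (∑-subsets≡C W t) ⟩
    ∣ W ∣ C t + ∣ W ∣ C suc t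
      ≡⟨ nCk+nC[k+1]≡[n+1]C[k+1] ∣ W ∣ t ⟩
    suc ∣ W ∣ C suc t ∎

C-suc : ∀ n k → suc n C suc k ≡ n C suc k + n C k
C-suc n k = trans (sym (nCk+nC[k+1]≡[n+1]C[k+1] n k)) (+-comm (n C k) (n C suc k))

C-step : ∀ n k → n C k ≤ suc n C k
C-step n zero = ≤-reflexive (trans (nC0≡1 n) (sym (nC0≡1 (suc n))))
C-step n (suc k) = ≤-trans (m≤m+n _ _) (≤-reflexive (sym (C-suc n k)))

C-monoˡ : ∀ {m n} k → m ≤ n → m C k ≤ n C k
C-monoˡ k m≤n = go k (≤⇒≤′ m≤n)
  where
  go : ∀ {m n} k → m ≤′ n → m C k ≤ n C k
  go k ≤′-refl = ≤-refl
  go k (≤′-step m≤n) = ≤-trans (go k m≤n) (C-step _ k)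

0<C : ∀ {n k} → k ≤ n → 0 < n C k
0<C {n} {zero} _ = ≤-reflexive (sym (nC0≡1 n))
0<C {suc n} {suc k} (s≤s k≤n) = ≤-trans (0<C k≤n) (≤-trans (m≤n+m _ _) (≤-reflexive (sym (C-suc n k))))

C-strictˡ : ∀ {m n k} → m < n → suc k ≤ n → m C suc k < n C suc k
C-strictˡ {m} {suc n} {k} (s≤s m≤n) (s≤s k≤n) = begin-strict
  m C suc k ≤⟨ C-monoˡ (suc k) m≤n ⟩
  n C suc k <⟨ m<m+n (n C suc k) (0<C k≤n) ⟩
  n C suc k + n C k ≡⟨ C-suc n k ⟨
  suc n C suc k ∎
  where open ≤-Reasoning

-- Discrete convexity in the upper argument: the pairs have equal sums and the right one is more
-- spread out. By induction on `j`, Pascal's rule makes each increment a comparison of coefficients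
-- with lower index one less.
C-convex : ∀ t a i j → (a + i) C t + (a + j) C t ≤ a C t + (a + i + j) C t
C-convex t a i zero = ≤-reflexive (trans (+-comm ((a + i) C t) _)
  (cong₂ (λ x y → x C t + y C t) (+-identityʳ a) (sym (+-identityʳ (a + i)))))
C-convex zero a i (suc j) = ≤-reflexive (cong₂ _+_
  (trans (nC0≡1 (a + i)) (sym (nC0≡1 a))) (trans (nC0≡1 (a + suc j)) (sym (nC0≡1 (a + i + suc j)))))
C-convex (suc t) a i (suc j) = begin
  (a + i) C suc t + (a + suc j) C suc t
    ≡⟨ cong (λ x → (a + i) C suc t + x C suc t) (+-suc a j) ⟩
  (a + i) C suc t + suc (a + j) C suc t
    ≡⟨ cong ((a + i) C suc t +_) (C-suc (a + j) t) ⟩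
  (a + i) C suc t + ((a + j) C suc t + (a + j) C t)
    ≡⟨ +-assoc ((a + i) C suc t) _ _ ⟨
  (a + i) C suc t + (a + j) C suc t + (a + j) C t
    ≤⟨ +-mono-≤ (C-convex (suc t) a i j) (C-monoˡ t (+-monoˡ-≤ j (m≤m+n a i))) ⟩
  a C suc t + (a + i + j) C suc t + (a + i + j) C t
    ≡⟨ +-assoc (a C suc t) _ _ ⟩
  a C suc t + ((a + i + j) C suc t + (a + i + j) C t)
    ≡⟨ cong (a C suc t +_) (C-suc (a + i + j) t) ⟨
  a C suc t + suc (a + i + j) C suc t
    ≡⟨ cong (λ x → a C suc t + x C suc t) (+-suc (a + i) j) ⟨
  a C suc t + (a + i + suc j) C suc t ∎
  where open ≤-Reasoning

-- Strictness of the last increment in `j` is enough. There the lower index is t - 1, which is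
-- positive because 2 ≤ t.
C-convex-strict : ∀ {t a i j} → 2 ≤ t → t ≤ a + i + j → 0 < i → 0 < j →
  (a + i) C t + (a + j) C t < a C t + (a + i + j) C t
C-convex-strict {suc (suc t)} {a} {i} {suc j} (s≤s (s≤s _)) t≤ 0<i _ = begin-strict
  (a + i) C k + (a + suc j) C k
    ≡⟨ cong (λ x → (a + i) C k + x C k) (+-suc a j) ⟩
  (a + i) C k + suc (a + j) C k
    ≡⟨ cong ((a + i) C k +_) (C-suc (a + j) (suc t)) ⟩
  (a + i) C k + ((a + j) C k + (a + j) C suc t)
    ≡⟨ +-assoc ((a + i) C k) _ _ ⟨
  (a + i) C k + (a + j) C k + (a + j) C suc t
    <⟨ +-mono-≤-< (C-convex k a i j)
      (C-strictˡ (+-monoˡ-< j (m<m+n a 0<i)) (≤-pred (≤-trans t≤ (≤-reflexive (+-suc (a + i) j))))) ⟩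
  a C k + (a + i + j) C k + (a + i + j) C suc t
    ≡⟨ +-assoc (a C k) _ _ ⟩
  a C k + ((a + i + j) C k + (a + i + j) C suc t)
    ≡⟨ cong (a C k +_) (C-suc (a + i + j) (suc t)) ⟨
  a C k + suc (a + i + j) C k
    ≡⟨ cong (λ x → a C k + x C k) (+-suc (a + i) j) ⟨
  a C k + (a + i + suc j) C k ∎
  where
  open ≤-Reasoning
  k = suc (suc t)

-- Counts over lists as cardinalities and sums.

countᵇ-tabulate : ∀ {m} {X : Set} (p : X → Bool) (f : Fin m → X) →
  countᵇ p (List.tabulate f) ≡ ∣ tabulate (p ∘ f) ∣
countᵇ-tabulate {zero} p f = refl
countᵇ-tabulate {suc m} p f with p (f zero)
... | true = cong suc (countᵇ-tabulate p (f ∘ suc))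
... | false = countᵇ-tabulate p (f ∘ suc)

countᵇ-++ : ∀ {X : Set} (p : X → Bool) xs ys → countᵇ p (xs ++ ys) ≡ countᵇ p xs + countᵇ p ys
countᵇ-++ p [] ys = refl
countᵇ-++ p (x ∷ xs) ys with p x
... | true = cong suc (countᵇ-++ p xs ys)
... | false = countᵇ-++ p xs ys

countᵇ-map : ∀ {X Y : Set} (p : Y → Bool) (f : X → Y) xs → countᵇ p (map f xs) ≡ countᵇ (p ∘ f) xs
countᵇ-map p f [] = refl
countᵇ-map p f (x ∷ xs) with p (f x)
... | true = cong suc (countᵇ-map p f xs)
... | false = countᵇ-map p f xs

countᵇ-allSubsets : ∀ n (p : Subset n → Bool) → countᵇ p (allSubsets n) ≡ ∑ (λ S → 𝟙 (p S Bool.≟ true))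
countᵇ-allSubsets zero p with p []
... | true = refl
... | false = refl
countᵇ-allSubsets (suc n) p = trans (countᵇ-++ p (map (outside ∷_) (allSubsets n)) _)
  (cong₂ _+_ (trans (countᵇ-map p (outside ∷_) (allSubsets n)) (countᵇ-allSubsets n (p ∘ (outside ∷_))))
    (trans (countᵇ-map p (inside ∷_) (allSubsets n)) (countᵇ-allSubsets n (p ∘ (inside ∷_)))))

-- Moving a vertex class to an initial segment.

toℕ-punchIn-fromℕ : ∀ {n} (i : Fin n) → toℕ (Fin.punchIn (fromℕ n) i) ≡ toℕ i
toℕ-punchIn-fromℕ zero = refl
toℕ-punchIn-fromℕ (suc i) = cong suc (toℕ-punchIn-fromℕ i)

-- The first vertex goes to position 0 if it lies in P and otherwise to the last position, which is
-- beyond the segment since a subset of the other vertices has at most n elements.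
separating : ∀ {n} (P : Subset n) → ∃ λ (π : Permutation′ n) →
  ∀ v → (toℕ (π ⟨$⟩ʳ v) <ᵇ ∣ P ∣) ≡ lookup P v
separating [] = Perm.id , λ ()
separating (inside ∷ P) with π , side ← separating P =
  Perm.lift₀ π , λ { zero → refl ; (suc v) → side v }
separating {suc n} (outside ∷ P) with π , side ← separating P = Perm.insert zero (fromℕ n) π , λ
  { zero → trans (cong (_<ᵇ ∣ P ∣) (Fin.toℕ-fromℕ n))
      (Bool.¬-not λ eq → <⇒≱ (<ᵇ⇒< n ∣ P ∣ (subst T (sym eq) _)) (∣p∣≤n P))
  ; (suc v) → trans (cong (_<ᵇ ∣ P ∣) (trans
      (cong toℕ (Perm.insert-punchIn zero (fromℕ n) π v)) (toℕ-punchIn-fromℕ (π ⟨$⟩ʳ v)))) (side v)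
  }

completeBipartite-adj : ∀ {n} δ (u v : Fin n) →
  adj (completeBipartite n δ) u v ≡ (toℕ u <ᵇ δ) xor (toℕ v <ᵇ δ)
completeBipartite-adj δ u v with toℕ u <ᵇ δ
... | true = refl
... | false = refl

-- The extremal function and its recursive inequality.

-- For D ≤ m this is C(D, t) + C(m − D, t); for m < D (and t > 0) it is C(m, t).
extremal : ℕ → ℕ → ℕ → ℕ
extremal t D m = (m ⊓ D) C t + (m ∸ D) C t

module _ {t} (3≤t : 3 ≤ t) where

  0Ct≡0 : 0 C t ≡ 0
  0Ct≡0 = k>n⇒nCk≡0 (≤-trans (s≤s z≤n) 3≤t)

  extremal-low : ∀ {D m} → m ≤ D → extremal t D m ≡ m C t
  extremal-low {D} {m} m≤D = begin
    (m ⊓ D) C t + (m ∸ D) C t ≡⟨ cong₂ (λ x y → x C t + y C t) (m≤n⇒m⊓n≡m m≤D) (m≤n⇒m∸n≡0 m≤D) ⟩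
    m C t + 0 C t ≡⟨ cong (m C t +_) 0Ct≡0 ⟩
    m C t + 0 ≡⟨ +-identityʳ _ ⟩
    m C t ∎
    where open ≡-Reasoning

  extremal-high : ∀ D s → extremal t D (D + s) ≡ D C t + s C t
  extremal-high D s = cong₂ (λ x y → x C t + y C t) (m≥n⇒m⊓n≡n (m≤m+n D s)) (m+n∸m≡n D s)

  -- Coordinates that fit the convexity inequality. In `low`, `a` is r + m - D, while `i` and `j`
  -- are the amounts by which m and r fall short of D.
  data Split (D r m : ℕ) : Set where
    low : ∀ a i j → r ≡ a + i → m ≡ a + j → D ≡ a + i + j → Split D r m
    high : ∀ s → r ≡ D + s → Split D r m

  split : ∀ {D r m} → m ≤ D → D ≤ r + m → Split D r m
  split {D} {r} {m} m≤D D≤r+m with ≤-total D r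
  ... | inj₁ D≤r = high (r ∸ D) (sym (m+[n∸m]≡n D≤r))
  ... | inj₂ r≤D = low (r ∸ (D ∸ m)) (D ∸ m) (D ∸ r) r≡ m≡ D≡
    where
    r≡ : r ≡ r ∸ (D ∸ m) + (D ∸ m)
    r≡ = sym (m∸n+n≡m (≤-trans (∸-monoˡ-≤ m D≤r+m) (≤-reflexive (m+n∸n≡m r m))))
    D≡ : D ≡ r ∸ (D ∸ m) + (D ∸ m) + (D ∸ r)
    D≡ = trans (sym (m+[n∸m]≡n r≤D)) (cong (_+ (D ∸ r)) r≡)
    m≡ : m ≡ r ∸ (D ∸ m) + (D ∸ r)
    m≡ = +-cancelˡ-≡ (D ∸ m) _ _ (trans (m∸n+n≡m m≤D) (trans D≡
      (trans (cong (_+ (D ∸ r)) (+-comm (r ∸ (D ∸ m)) (D ∸ m))) (+-assoc (D ∸ m) _ _))))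

  low-sum : ∀ a i j → (a + i) + (a + j) ≡ (a + i + j) + a
  low-sum a i j = trans (cong ((a + i) +_) (+-comm a j)) (sym (+-assoc (a + i) j a))

  extremal-low₂ : ∀ a i j → extremal t (a + i + j) ((a + i) + (a + j)) ≡ a C t + (a + i + j) C t
  extremal-low₂ a i j = trans (cong (extremal t (a + i + j)) (low-sum a i j))
    (trans (extremal-high (a + i + j) a) (+-comm ((a + i + j) C t) _))

  -- If r ≤ D, convexity spreads the pair (r, m) to (r + m - D, D). If r = D + s, the part D stays
  -- fixed and merging s with m does not decrease the count, because `0 C t` vanishes.
  extremal-step : ∀ {D r m} → m ≤ D → D ≤ r + m → extremal t D r + m C t ≤ extremal t D (r + m)
  extremal-step {D} {r} {m} m≤D D≤r+m with split m≤D D≤r+m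
  ... | low a i j refl refl refl = begin
    extremal t (a + i + j) (a + i) + (a + j) C t ≡⟨ cong (_+ (a + j) C t) (extremal-low (m≤m+n (a + i) j)) ⟩
    (a + i) C t + (a + j) C t ≤⟨ C-convex t a i j ⟩
    a C t + (a + i + j) C t ≡⟨ extremal-low₂ a i j ⟨
    extremal t (a + i + j) ((a + i) + (a + j)) ∎
    where open ≤-Reasoning
  ... | high s refl = begin
    extremal t D (D + s) + m C t ≡⟨ cong (_+ m C t) (extremal-high D s) ⟩
    D C t + s C t + m C t ≡⟨ +-assoc (D C t) _ _ ⟩
    D C t + (s C t + m C t) ≤⟨ +-monoʳ-≤ (D C t) (C-convex t 0 s m) ⟩
    D C t + (0 C t + (s + m) C t) ≡⟨ cong (λ x → D C t + (x + (s + m) C t)) 0Ct≡0 ⟩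
    D C t + (s + m) C t ≡⟨ extremal-high D (s + m) ⟨
    extremal t D (D + (s + m)) ≡⟨ cong (extremal t D) (+-assoc D s m) ⟨
    extremal t D (D + s + m) ∎
    where open ≤-Reasoning

  -- Strict convexity excludes every split with positive gaps. A vanishing `i` gives m = D, and a
  -- vanishing `j` or `s` gives r = D.
  extremal-step-tight : ∀ {D r m δ} → m ≤ D → 0 < m → t ≤ δ → δ ≤ D → r + m ≡ D + δ →
    extremal t D (r + m) ≤ extremal t D r + m C t → (r ≡ D × m ≡ δ) ⊎ (r ≡ δ × m ≡ D)
  extremal-step-tight {D} {r} {m} {δ} m≤D 0<m t≤δ δ≤D r+m≡ h
    with split m≤D (≤-trans (m≤m+n D δ) (≤-reflexive (sym r+m≡)))
  ... | low a zero j refl refl refl = inj₂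
    ( +-cancelˡ-≡ (a + j) _ _ (trans (+-comm (a + j) (a + 0)) (trans r+m≡ (cong (λ x → x + j + δ) (+-identityʳ a))))
    , cong (_+ j) (sym (+-identityʳ a)) )
  ... | low a i zero refl refl refl = inj₁
    ( sym (+-identityʳ (a + i))
    , +-cancelˡ-≡ (a + i) _ _ (trans r+m≡ (cong (_+ δ) (+-identityʳ (a + i)))) )
  ... | low a i@(suc _) j@(suc _) refl refl refl = contradiction h (<⇒≱ (begin-strict
    extremal t (a + i + j) (a + i) + (a + j) C t ≡⟨ cong (_+ (a + j) C t) (extremal-low (m≤m+n (a + i) j)) ⟩
    (a + i) C t + (a + j) C t 
      <⟨ C-convex-strict {t} {a} {i} {j} (≤-trans (n≤1+n 2) 3≤t) (≤-trans t≤δ δ≤D) (s≤s z≤n) (s≤s z≤n) ⟩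
    a C t + (a + i + j) C t ≡⟨ extremal-low₂ a i j ⟨
    extremal t (a + i + j) ((a + i) + (a + j)) ∎))
    where open ≤-Reasoning
  ... | high zero refl = inj₁ (+-identityʳ D , +-cancelˡ-≡ D _ _ (trans (cong (_+ m) (sym (+-identityʳ D))) r+m≡))
  -- Here D + s + m = D + δ, so s + m = δ, and t ≤ δ is the size condition for strict convexity.
  ... | high s@(suc _) refl = contradiction h (<⇒≱ (begin-strict
    extremal t D (D + s) + m C t ≡⟨ cong (_+ m C t) (extremal-high D s) ⟩
    D C t + s C t + m C t ≡⟨ +-assoc (D C t) _ _ ⟩
    D C t + (s C t + m C t) 
      <⟨ +-monoʳ-< (D C t) (C-convex-strict {t} {0} {s} {m} (≤-trans (n≤1+n 2) 3≤t)
        (≤-trans t≤δ (≤-reflexive (sym (+-cancelˡ-≡ D _ _ (trans (sym (+-assoc D s m)) r+m≡))))) (s≤s z≤n) 0<m) ⟩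
    D C t + (0 C t + (s + m) C t) ≡⟨ cong (λ x → D C t + (x + (s + m) C t)) 0Ct≡0 ⟩
    D C t + (s + m) C t ≡⟨ extremal-high D (s + m) ⟨
    extremal t D (D + (s + m)) ≡⟨ cong (extremal t D) (+-assoc D s m) ⟨
    extremal t D (D + s + m) ∎))
    where open ≤-Reasoning

-- Neighbourhoods and independent sets of a graph.

⊈⇒∃ : ∀ {n} {p q : Subset n} → ¬ (p ⊆ q) → ∃ λ x → x ∈ p × x ∉ q
⊈⇒∃ {p = p} {q} p⊈q with Fin.any? (λ x → (x ∈? p) ×-dec ¬? (x ∈? q))
... | yes found = found
... | no none = contradiction (λ {x} → p⊆q {x}) p⊈q
  where
  p⊆q : p ⊆ q
  p⊆q {x} x∈p with x ∈? q
  ... | yes x∈q = x∈q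
  ... | no x∉q = contradiction (x , x∈p , x∉q) none

all-sound : ∀ {X : Set} (p : X → Bool) {x} xs → x List.∈ xs → all p xs ≡ true → p x ≡ true
all-sound p (y ∷ xs) (here refl) eq with true ← p y = refl
all-sound p (y ∷ xs) (there x∈xs) eq with true ← p y = all-sound p xs x∈xs eq

all-complete : ∀ {X : Set} (p : X → Bool) xs → (∀ x → p x ≡ true) → all p xs ≡ true
all-complete p [] h = refl
all-complete p (x ∷ xs) h = cong₂ _∧_ (h x) (all-complete p xs h)

module _ {n} (G : Graph n) where

  N : Fin n → Subset n
  N v = tabulate (adj G v)

  ∈N⇒adj : ∀ {u v} → v ∈ N u → adj G u v ≡ true
  ∈N⇒adj {u} {v} v∈N = trans (sym (lookup∘tabulate (adj G u) v)) ([]=⇒lookup v∈N)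

  adj⇒∈N : ∀ {u v} → adj G u v ≡ true → v ∈ N u
  adj⇒∈N {u} {v} eq = lookup⇒[]= v _ (trans (lookup∘tabulate (adj G u) v) eq)

  N-sym : ∀ {u v} → v ∈ N u → u ∈ N v
  N-sym {u} {v} v∈N = adj⇒∈N (trans (Graph.sym G v u) (∈N⇒adj v∈N))

  N-irrefl : ∀ {v} → v ∉ N v
  N-irrefl {v} v∈N with () ← trans (sym (irrefl G v)) (∈N⇒adj v∈N)

  Independent : Subset n → Set
  Independent S = ∀ {u v} → u ∈ S → v ∈ S → v ∉ N u

  isIndependentᵇ-sound : ∀ S → isIndependentᵇ G S ≡ true → Independent S
  isIndependentᵇ-sound S eq {u} {v} u∈S v∈S v∈N = clash ([]=⇒lookup u∈S) ([]=⇒lookup v∈S) (∈N⇒adj v∈N)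
    (all-sound _ (allFin n) (∈-allFin v) (all-sound _ (allFin n) (∈-allFin u) (trans (sym (isIndependentᵇ≡ G S)) eq)))
    where
    clash : ∀ {a b c} → a ≡ true → b ≡ true → c ≡ true → not (a ∧ (b ∧ c)) ≡ true → ⊥
    clash refl refl refl ()

  isIndependentᵇ-complete : ∀ S → Independent S → isIndependentᵇ G S ≡ true
  isIndependentᵇ-complete S ind = trans (isIndependentᵇ≡ G S)
    (all-complete _ (allFin n) λ u → all-complete _ (allFin n) λ v → pair u v)
    where
    pair : ∀ u v → not (lookup S u ∧ (lookup S v ∧ adj G u v)) ≡ true
    pair u v with lookup S u in eu | lookup S v in ev | adj G u v in ea
    ... | false | _ | _ = refl
    ... | true | false | _ = refl
    ... | true | true | false = refl
    ... | true | true | true = contradiction (adj⇒∈N ea) (ind (lookup⇒[]= u S eu) (lookup⇒[]= v S ev))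

  independent? : ∀ S → Dec (Independent S)
  independent? S = map′ (isIndependentᵇ-sound S) (isIndependentᵇ-complete S) (isIndependentᵇ G S Bool.≟ true)

  -- The inequality about a single vertex set.

  module _ (U : Subset n) where

    -- What it means for `U - v` to escape N(v), with sizes and the ambient set left out: every edge
    -- inside U passes through v, yet v misses some other vertex of U. `Isolated` is the matching
    -- form of avoiding N(v).
    CoversEdges : Fin n → Set
    CoversEdges v = v ∈ U × Independent (U - v) × ∃ λ x → x ∈ U × x ≢ v × x ∉ N v

    coversEdges? : ∀ v → Dec (CoversEdges v)
    coversEdges? v = (v ∈? U) ×-dec independent? (U - v) ×-dec
      Fin.any? λ x → (x ∈? U) ×-dec ¬? (x Fin.≟ v) ×-dec ¬? (x ∈? N v)

    Isolated : Fin n → Set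
    Isolated v = v ∈ U × Subset.Lift (_∉ N v) U

    isolated? : ∀ v → Dec (Isolated v)
    isolated? v = (v ∈? U) ×-dec Lift? (λ x → ¬? (x ∈? N v)) U

    -- If v on the left is not isolated in U, with a neighbour y ∈ U and a non-neighbour x ∈ U, then
    -- only v and y can occur on the left.  If v is alone then x is isolated; if y also occurs
    -- then all of U except v and y is isolated, and 4 ≤ |U| leaves two such vertices.
    coversEdges≤isolated : 4 ≤ ∣ U ∣ →
      sum (λ v → 𝟙 (coversEdges? v)) ≤ sum (λ v → 𝟙 (isolated? v))
    coversEdges≤isolated 4≤∣U∣
      with Fin.any? (λ v → coversEdges? v ×-dec ¬? (isolated? v))
    ... | no none = sum-mono λ v → 𝟙-mono (coversEdges? v) (isolated? v) (λ A → isolated v A)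
      where
      isolated : ∀ v → CoversEdges v → Isolated v
      isolated v A with isolated? v
      ... | yes B = B
      ... | no ¬B = contradiction (v , A , ¬B) none
    ... | yes (v , (v∈U , ind-v , x , x∈U , x≢v , x∉Nv) , ¬isolated)
      with Fin.any? (λ w → coversEdges? w ×-dec ¬? (w Fin.≟ v))
    ... | no none = begin
        sum (λ w → 𝟙 (coversEdges? w))
          ≤⟨ sum-mono (λ w → 𝟙-mono (coversEdges? w) (w Fin.≟ v) (unique w)) ⟩
        sum (λ w → 𝟙 (w Fin.≟ v))
          ≡⟨ trans (sum-𝟙≟ v) (sym (sum-𝟙≟ x)) ⟩
        sum (λ w → 𝟙 (w Fin.≟ x))
          ≤⟨ sum-mono (λ w → 𝟙-mono (w Fin.≟ x) (isolated? w) λ { refl → x∈U , isolated-x }) ⟩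
        sum (λ w → 𝟙 (isolated? w)) ∎
      where
      open ≤-Reasoning
      unique : ∀ w → CoversEdges w → w ≡ v
      unique w A with w Fin.≟ v
      ... | yes w≡v = w≡v
      ... | no w≢v = contradiction (w , A , w≢v) none
      isolated-x : Subset.Lift (_∉ N x) U
      isolated-x {y} y∈U with y Fin.≟ v
      ... | yes refl = x∉Nv ∘ N-sym
      ... | no y≢v = ind-v (x∈p∧x≢y⇒x∈p-y x∈U x≢v) (x∈p∧x≢y⇒x∈p-y y∈U y≢v)
    ... | yes (w , (w∈U , ind-w , _) , w≢v) = +-boundʳ {2} {_} {2} (begin
        2 + sum (λ u → 𝟙 (coversEdges? u)) 
          ≤⟨ +-monoʳ-≤ 2 (≤-trans
            (sum-mono λ u → 𝟙-cover (coversEdges? u) (u Fin.≟ v) (u Fin.≟ w) (v-or-w u))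
            (≤-reflexive twice)) ⟩
        4
          ≤⟨ 4≤∣U∣ ⟩
        ∣ U ∣
          ≡⟨ ∣∣≡sum U ⟩
        sum (λ u → 𝟙 (u ∈? U))
          ≤⟨ sum-mono cover ⟩
        sum (λ u → 𝟙 (u Fin.≟ v) + 𝟙 (u Fin.≟ w) + 𝟙 (isolated? u))
          ≡⟨ ∑-distrib-+ {n} _ _ ⟩
        sum (λ u → 𝟙 (u Fin.≟ v) + 𝟙 (u Fin.≟ w)) + sum (λ u → 𝟙 (isolated? u))
          ≡⟨ cong (_+ sum (λ u → 𝟙 (isolated? u))) twice ⟩
        2 + sum (λ u → 𝟙 (isolated? u)) ∎) ≤-refl
      where
      open ≤-Reasoning
      twice : sum {n} (λ u → 𝟙 (u Fin.≟ v) + 𝟙 (u Fin.≟ w)) ≡ 2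
      twice = trans (∑-distrib-+ {n} _ _) (cong₂ _+_ (sum-𝟙≟ v) (sum-𝟙≟ w))
      neighbour : ∃ λ y → y ∈ U × y ∈ N v
      neighbour with Fin.any? (λ y → (y ∈? U) ×-dec (y ∈? N v))
      ... | yes found = found
      ... | no none = ⊥-elim (¬isolated (v∈U , λ {y} y∈U y∈N → none (y , y∈U , y∈N)))
      v-or-w : ∀ u → CoversEdges u → u ≡ v ⊎ u ≡ w
      v-or-w u (u∈U , ind-u , _) with u Fin.≟ v | u Fin.≟ w
      ... | yes u≡v | _ = inj₁ u≡v
      ... | _ | yes u≡w = inj₂ u≡w
      -- The edge from v to y survives in `U - u` when y differs from u, and in `U - w` when y is u.
      -- Either way a set assumed independent contains an edge.
      ... | no u≢v | no u≢w with y , y∈U , y∈N ← neighbour with y Fin.≟ u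
      ... | no y≢u = contradiction y∈N (ind-u (x∈p∧x≢y⇒x∈p-y v∈U (u≢v ∘ sym)) (x∈p∧x≢y⇒x∈p-y y∈U y≢u))
      ... | yes refl = contradiction y∈N (ind-w (x∈p∧x≢y⇒x∈p-y v∈U (w≢v ∘ sym)) (x∈p∧x≢y⇒x∈p-y y∈U u≢w))
      cover : ∀ u → 𝟙 (u ∈? U) ≤ 𝟙 (u Fin.≟ v) + 𝟙 (u Fin.≟ w) + 𝟙 (isolated? u)
      cover u with u Fin.≟ v | u Fin.≟ w
      ... | yes _ | _ = ≤-trans (𝟙≤1 (u ∈? U)) (s≤s z≤n)
      ... | no _ | yes _ = ≤-trans (𝟙≤1 (u ∈? U)) (s≤s z≤n)
      ... | no u≢v | no u≢w = 𝟙-mono (u ∈? U) (isolated? u) λ u∈U → u∈U , isolated-u u∈U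
        where
        isolated-u : u ∈ U → Subset.Lift (_∉ N u) U
        isolated-u u∈U {y} y∈U with y Fin.≟ v
        ... | no y≢v = ind-v (x∈p∧x≢y⇒x∈p-y u∈U u≢v) (x∈p∧x≢y⇒x∈p-y y∈U y≢v)
        ... | yes refl = ind-w (x∈p∧x≢y⇒x∈p-y u∈U u≢w) (x∈p∧x≢y⇒x∈p-y y∈U (w≢v ∘ sym))

  -- Counting independent t-sets and averaging over vertices.

  module _ (t : ℕ) where

    indep⊆? : ∀ W S → Dec (∣ S ∣ ≡ t × S ⊆ W × Independent S)
    indep⊆? W S = (∣ S ∣ ≟ t) ×-dec (S ⊆? W) ×-dec independent? S

    #indep : Subset n → ℕ
    #indep W = ∑ λ S → 𝟙 (indep⊆? W S)

    #indep≤C : ∀ W → #indep W ≤ ∣ W ∣ C t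
    #indep≤C W = ≤-trans (∑-mono λ S → 𝟙-mono (indep⊆? W S) (sized⊆? t W S) λ (e , s , _) → e , s)
      (≤-reflexive (∑-subsets≡C W t))

    -- The comparison with all t-subsets of W is termwise, so reaching their number leaves no
    -- dependent one.
    #indep-full : ∀ {W S} → ∣ W ∣ C t ≤ #indep W → ∣ S ∣ ≡ t → S ⊆ W → Independent S
    #indep-full {W} {S} h e s with indep⊆? W S | ∑-mono-tight
      (λ S → 𝟙-mono (indep⊆? W S) (sized⊆? t W S) λ (e , s , _) → e , s)
      (≤-trans (≤-reflexive (∑-subsets≡C W t)) h) S
    ... | yes (_ , _ , ind) | _ = ind
    ... | no _ | ≤0 = contradiction (e , λ {x} → s {x}) (𝟙-zero (sized⊆? t W S) ≤0)

    module _ (W : Subset n) where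

      -- The condition `v ∈ W` is built in, so that sums over all vertices are sums over W.
      escaping? : ∀ v S → Dec (v ∈ W × (∣ S ∣ ≡ t × S ⊆ W × Independent S) × ¬ S ⊆ N v)
      escaping? v S = (v ∈? W) ×-dec indep⊆? W S ×-dec ¬? (S ⊆? N v)

      avoiding? : ∀ v S → Dec (v ∈ W × ∣ S ∣ ≡ t × S ⊆ W ─ N v)
      avoiding? v S = (v ∈? W) ×-dec sized⊆? t (W ─ N v) S

      -- These sets measure the slack in comparing escaping with avoiding sets through v. Keeping
      -- them in `averaging` shows in the equality case that there are none.
      dependent? : ∀ v S → Dec (v ∈ S × (∣ S ∣ ≡ t × S ⊆ W ─ N v) × ¬ Independent S)
      dependent? v S = (v ∈? S) ×-dec sized⊆? t (W ─ N v) S ×-dec ¬? (independent? S)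

      #escaping #avoiding #dependent : Fin n → ℕ
      #escaping v = ∑ λ S → 𝟙 (escaping? v S)
      #avoiding v = ∑ λ S → 𝟙 (avoiding? v S)
      #dependent v = ∑ λ S → 𝟙 (dependent? v S)

      ─N⊆ : ∀ {v} {S : Subset n} → S ⊆ W ─ N v → S ⊆ W
      ─N⊆ {v} S⊆ x∈S = p─q⊆p W (N v) (S⊆ x∈S)

      #indep≤∩N+escaping : ∀ {v} → v ∈ W → #indep W ≤ #indep (W ∩ N v) + #escaping v
      #indep≤∩N+escaping {v} v∈W = ≤-trans
        (∑-mono λ S → 𝟙-cover (indep⊆? W S) (indep⊆? (W ∩ N v) S) (escaping? v S) (stays-or-escapes S))
        (≤-reflexive (∑-distrib (λ S → 𝟙 (indep⊆? (W ∩ N v) S)) (λ S → 𝟙 (escaping? v S))))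
        where
        stays-or-escapes : ∀ S → ∣ S ∣ ≡ t × S ⊆ W × Independent S →
          (∣ S ∣ ≡ t × S ⊆ W ∩ N v × Independent S) ⊎
          (v ∈ W × (∣ S ∣ ≡ t × S ⊆ W × Independent S) × ¬ S ⊆ N v)
        stays-or-escapes S (e , s , i) with S ⊆? N v
        ... | yes S⊆N = inj₁ (e , (λ x∈S → x∈p∩q⁺ (s x∈S , S⊆N x∈S)) , λ {u} {v} → i {u} {v})
        ... | no S⊈N = inj₂ (v∈W , (e , (λ {x} → s {x}) , λ {u} {v} → i {u} {v}) , S⊈N)

      #avoiding≡C : ∀ {v} → v ∈ W → #avoiding v ≡ ∣ W ─ N v ∣ C t
      #avoiding≡C {v} v∈W = trans
        (∑-cong λ S → 𝟙-cong (avoiding? v S) (sized⊆? t (W ─ N v) S) proj₂ (λ x → v∈W , x))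
        (∑-subsets≡C (W ─ N v) t)

      #avoiding-∉ : ∀ {v} → v ∉ W → #avoiding v ≡ 0
      #avoiding-∉ {v} v∉W = trans (∑-cong λ S → 𝟙-no (avoiding? v S) (v∉W ∘ proj₁)) (∑-zero n)

      -- S = U − v escapes N v exactly when v is a non-neighbour of some vertex of U − v.
      escaping-swap : 3 ≤ t → ∀ U →
        sum (λ v → 𝟙 (v ∈? U) * 𝟙 (escaping? v (U - v))) ≤
        sum (λ v → 𝟙 (v ∈? U) * 𝟙 (avoiding? v (U - v)))
      escaping-swap 3≤t U with (∣ U ∣ ≟ suc t) ×-dec (U ⊆? W)
      ... | no ¬U = sum-mono λ v → begin
          𝟙 (v ∈? U) * 𝟙 (escaping? v (U - v)) ≡⟨ 𝟙-× (v ∈? U) (escaping? v (U - v)) ⟩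
          𝟙 ((v ∈? U) ×-dec escaping? v (U - v)) ≡⟨ 𝟙-no _ (impossible v) ⟩
          0 ≤⟨ z≤n ⟩
          𝟙 (v ∈? U) * 𝟙 (avoiding? v (U - v)) ∎
        where
        open ≤-Reasoning
        impossible : ∀ v → ¬ (v ∈ U × v ∈ W × (∣ U - v ∣ ≡ t × U - v ⊆ W × Independent (U - v)) × ¬ U - v ⊆ N v)
        impossible v (v∈U , v∈W , (e , s , _) , _) = ¬U (trans (sym (suc∣p-x∣≡∣p∣ v∈U)) (cong suc e) , U⊆W)
          where
          U⊆W : U ⊆ W
          U⊆W {x} x∈U with x Fin.≟ v
          ... | yes refl = v∈W
          ... | no x≢v = s (x∈p∧x≢y⇒x∈p-y x∈U x≢v)
      ... | yes (∣U∣≡ , U⊆W) = begin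
          sum (λ v → 𝟙 (v ∈? U) * 𝟙 (escaping? v (U - v)))
            ≤⟨ sum-mono (λ v → ≤-trans (≤-reflexive (𝟙-× (v ∈? U) (escaping? v (U - v))))
              (𝟙-mono _ (coversEdges? U v) (to v))) ⟩
          sum (λ v → 𝟙 (coversEdges? U v))
            ≤⟨ coversEdges≤isolated U (≤-trans (s≤s 3≤t) (≤-reflexive (sym ∣U∣≡))) ⟩
          sum (λ v → 𝟙 (isolated? U v))
            ≤⟨ sum-mono (λ v → ≤-trans (𝟙-mono (isolated? U v) _ (from v))
              (≤-reflexive (sym (𝟙-× (v ∈? U) (avoiding? v (U - v)))))) ⟩
          sum (λ v → 𝟙 (v ∈? U) * 𝟙 (avoiding? v (U - v))) ∎
        where
        open ≤-Reasoning
        to : ∀ v → v ∈ U × v ∈ W × (∣ U - v ∣ ≡ t × U - v ⊆ W × Independent (U - v)) × ¬ U - v ⊆ N v →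
          CoversEdges U v
        to v (v∈U , v∈W , (_ , _ , ind) , ⊈N) with x , x∈U-v , x∉N ← ⊈⇒∃ ⊈N =
          v∈U , (λ {u} {w} → ind {u} {w}) , x , p─q⊆p U ⁅ v ⁆ x∈U-v ,
            (λ { refl → x∈p─q⇒x∉q U ⁅ v ⁆ x∈U-v (x∈⁅x⁆ v) }) , x∉N
        from : ∀ v → Isolated U v → v ∈ U × v ∈ W × ∣ U - v ∣ ≡ t × U - v ⊆ W ─ N v
        from v (v∈U , iso) = v∈U , U⊆W v∈U , suc-injective (trans (suc∣p-x∣≡∣p∣ v∈U) ∣U∣≡) ,
          λ x∈ → x∈p∧x∉q⇒x∈p─q (U⊆W (p─q⊆p U ⁅ v ⁆ x∈)) (iso (p─q⊆p U ⁅ v ⁆ x∈))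

      -- Sets through v are compared pointwise (`inner`). Sets missing v (`outer`) are reindexed by
      -- `∑-remove`, and exchanging the two sums leaves `escaping-swap` for each U.
      averaging : 3 ≤ t → sum (λ v → #escaping v + #dependent v) ≤ sum #avoiding
      averaging 3≤t = begin
        sum (λ v → #escaping v + #dependent v)
          ≤⟨ sum-mono (λ v → ≤-trans (≤-reflexive (sym (∑-distrib (𝟙 ∘ escaping? v) (𝟙 ∘ dependent? v))))
            (≤-trans (∑-mono (pointwise v)) (≤-reflexive (∑-distrib (outer (𝟙 ∘ escaping? v) v) (inner v))))) ⟩
        sum (λ v → ∑ (outer (𝟙 ∘ escaping? v) v) + ∑ (inner v))
          ≡⟨ ∑-distrib-+ {n} _ _ ⟩
        sum (λ v → ∑ (outer (𝟙 ∘ escaping? v) v)) + sum (λ v → ∑ (inner v))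
          ≤⟨ +-monoˡ-≤ _ outer≤ ⟩
        sum (λ v → ∑ (outer (𝟙 ∘ avoiding? v) v)) + sum (λ v → ∑ (inner v))
          ≡⟨ ∑-distrib-+ {n} _ _ ⟨
        sum (λ v → ∑ (outer (𝟙 ∘ avoiding? v) v) + ∑ (inner v))
          ≡⟨ sum-cong-≗ (λ v → trans (sym (∑-distrib (outer (𝟙 ∘ avoiding? v) v) (inner v)))
            (∑-cong (recombine v))) ⟩
        sum #avoiding ∎
        where
        open ≤-Reasoning
        outer : (Subset n → ℕ) → Fin n → Subset n → ℕ
        outer h v S = 𝟙 (¬? (v ∈? S)) * h S
        inner : Fin n → Subset n → ℕ
        inner v S = 𝟙 (v ∈? S) * 𝟙 (avoiding? v S)
        removed : ∀ (h : Fin n → Subset n → ℕ) →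
          sum (λ v → ∑ (outer (h v) v)) ≡ ∑ (λ U → sum (λ v → 𝟙 (v ∈? U) * h v (U - v)))
        removed h = trans (sum-cong-≗ λ v → ∑-remove v (h v)) (∑-sum-comm λ v U → 𝟙 (v ∈? U) * h v (U - v))
        outer≤ : sum (λ v → ∑ (outer (𝟙 ∘ escaping? v) v)) ≤ sum (λ v → ∑ (outer (𝟙 ∘ avoiding? v) v))
        outer≤ = begin
          sum (λ v → ∑ (outer (𝟙 ∘ escaping? v) v)) ≡⟨ removed (λ v → 𝟙 ∘ escaping? v) ⟩
          ∑ (λ U → sum (λ v → 𝟙 (v ∈? U) * 𝟙 (escaping? v (U - v)))) ≤⟨ ∑-mono (escaping-swap 3≤t) ⟩
          ∑ (λ U → sum (λ v → 𝟙 (v ∈? U) * 𝟙 (avoiding? v (U - v)))) ≡⟨ removed (λ v → 𝟙 ∘ avoiding? v) ⟨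
          sum (λ v → ∑ (outer (𝟙 ∘ avoiding? v) v)) ∎
        recombine : ∀ v S → outer (𝟙 ∘ avoiding? v) v S + inner v S ≡ 𝟙 (avoiding? v S)
        recombine v S with v ∈? S
        ... | yes _ = +-identityʳ _
        ... | no _ = trans (+-identityʳ _) (+-identityʳ _)
        pointwise : ∀ v S → 𝟙 (escaping? v S) + 𝟙 (dependent? v S) ≤ outer (𝟙 ∘ escaping? v) v S + inner v S
        pointwise v S with v ∈? S
        ... | no v∉S = ≤-reflexive (sym (+-identityʳ _))
        -- An independent S through v contains no neighbour of v, so it avoids N(v). Dependent
        -- avoiding sets are further avoiding sets, disjoint from these.
        ... | yes v∈S = ≤-trans
          (𝟙-disjoint (avoiding? v S) (escaping? v S)
            (yes v∈S ×-dec sized⊆? t (W ─ N v) S ×-dec ¬? (independent? S))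
            (λ (v∈W , (e , s , i) , _) → v∈W , e , λ x∈S → x∈p∧x∉q⇒x∈p─q (s x∈S) (i v∈S x∈S))
            (λ (_ , (e , s) , _) → ─N⊆ s v∈S , e , s)
            (λ (_ , (_ , _ , i) , _) (_ , _ , ¬i) → ¬i (λ {u} {w} → i {u} {w})))
          (≤-reflexive (sym (+-identityʳ _)))

    -- The upper bound by induction on the vertex set.

    module _ (3≤t : 3 ≤ t) where

      -- Were every vertex of W bad, the inequality between the terms of `averaging` would be
      -- reversed everywhere, hence tight everywhere, and any vertex of W would be good after all.
      goodVertex : ∀ W → 0 < ∣ W ∣ → ∃ λ v → v ∈ W × #escaping W v ≤ #avoiding W v
      goodVertex W 0<∣W∣ with Fin.any? (λ v → (v ∈? W) ×-dec (#escaping W v ≤? #avoiding W v))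
      ... | yes found = found
      ... | no none with w , w∈W ← ∣p∣>0⇒Nonempty W 0<∣W∣ = contradiction
        (w , w∈W , ≤-trans (m≤m+n _ _) (sum-mono-tight avoiding≤ (averaging W 3≤t) w)) none
        where
        none-good : ∀ v → Dec (v ∈ W) → Dec (#escaping W v ≤ #avoiding W v) →
          #avoiding W v ≤ #escaping W v
        none-good v (no v∉W) _ = ≤-trans (≤-reflexive (#avoiding-∉ W v∉W)) z≤n
        none-good v (yes v∈W) (yes e≤a) = contradiction (v , v∈W , e≤a) none
        none-good v (yes v∈W) (no e≰a) = <⇒≤ (≰⇒> e≰a)
        avoiding≤ : ∀ v → #avoiding W v ≤ #escaping W v + #dependent W v
        avoiding≤ v = ≤-trans (none-good v (v ∈? W) (#escaping W v ≤? #avoiding W v)) (m≤m+n _ _)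

      v∈W─N : ∀ {W v} → v ∈ W → v ∈ W ─ N v
      v∈W─N v∈W = x∈p∧x∉q⇒x∈p─q v∈W N-irrefl

      0<∣W─N∣ : ∀ {W v} → v ∈ W → 0 < ∣ W ─ N v ∣
      0<∣W─N∣ v∈W = ≤-trans (s≤s z≤n) (≤-reflexive (suc∣p-x∣≡∣p∣ (v∈W─N v∈W)))

      module _ (D : ℕ) (codegree≤D : ∀ v → ∣ ⊤ ─ N v ∣ ≤ D) where

        #indep≤extremal : ∀ W → #indep W ≤ extremal t D ∣ W ∣
        #indep≤extremal W = go W (<-wellFounded ∣ W ∣)
          where
          open ≤-Reasoning
          go : ∀ W → Acc _<_ ∣ W ∣ → #indep W ≤ extremal t D ∣ W ∣
          go W (acc rec) with ∣ W ∣ ≤? D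
          -- The induction stops at D rather than at the empty set: up to there the trivial bound is
          -- the extremal value, and beyond it `extremal-step` applies.
          ... | yes ∣W∣≤D = ≤-trans (#indep≤C W) (≤-reflexive (sym (extremal-low 3≤t ∣W∣≤D)))
          ... | no ∣W∣≰D with v , v∈W , e≤a ← goodVertex W (≤-trans (s≤s z≤n) (≰⇒> ∣W∣≰D)) = begin
            #indep W
              ≤⟨ #indep≤∩N+escaping W v∈W ⟩
            #indep (W ∩ N v) + #escaping W v
              ≤⟨ +-mono-≤ (go (W ∩ N v) (rec smaller)) (≤-trans e≤a (≤-reflexive (#avoiding≡C W v∈W))) ⟩
            extremal t D ∣ W ∩ N v ∣ + ∣ W ─ N v ∣ C t
              ≤⟨ extremal-step 3≤t (≤-trans (p⊆q⇒∣p∣≤∣q∣ (─-monoˡ {p = W} (N v) ⊆⊤)) (codegree≤D v))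
                (≤-trans (<⇒≤ (≰⇒> ∣W∣≰D)) (≤-reflexive (sym parts))) ⟩
            extremal t D (∣ W ∩ N v ∣ + ∣ W ─ N v ∣)
              ≡⟨ cong (extremal t D) parts ⟩
            extremal t D ∣ W ∣ ∎
            where
            parts : ∣ W ∩ N v ∣ + ∣ W ─ N v ∣ ≡ ∣ W ∣
            parts = ∣p∩q∣+∣p─q∣≡∣p∣ W (N v)
            smaller : ∣ W ∩ N v ∣ < ∣ W ∣
            -- The vertex v itself lies in `W ─ N v`, so passing to `W ∩ N v` loses at least one
            -- vertex.
            smaller = ≤-trans (m<m+n _ (0<∣W─N∣ v∈W)) (≤-reflexive parts)

        -- The structure of graphs attaining the bound.

        module Optimal {δ} (t≤δ : t ≤ δ) (δ≤D : δ ≤ D) (n≡D+δ : n ≡ D + δ)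
          (optimal : extremal t D n ≤ #indep ⊤) where

          step : ∀ v → extremal t D ∣ N v ∣ + ∣ ⊤ ─ N v ∣ C t ≤ extremal t D n
          step v = ≤-trans (extremal-step 3≤t (codegree≤D v)
              (≤-trans (m≤m+n D δ) (≤-reflexive (sym (trans (∣p∣+∣⊤─p∣≡n (N v)) n≡D+δ)))))
            (≤-reflexive (cong (extremal t D) (∣p∣+∣⊤─p∣≡n (N v))))

          recursion : ∀ v → extremal t D n ≤ #indep (N v) + #escaping ⊤ v
          recursion v = ≤-trans optimal (≤-trans (#indep≤∩N+escaping ⊤ ∈⊤)
            (≤-reflexive (cong (λ p → #indep p + #escaping ⊤ v) (∩-identityˡ (N v)))))

          -- The independent t-sets inside N(v) stay below their extremal value, so an optimal total
          -- leaves at least C(|V ∖ N(v)|, t) sets to escape.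
          avoiding≤escaping : ∀ v → #avoiding ⊤ v ≤ #escaping ⊤ v
          avoiding≤escaping v = ≤-trans (≤-reflexive (#avoiding≡C ⊤ ∈⊤))
            (+-boundʳ (≤-trans (step v) (recursion v)) (#indep≤extremal (N v)))

          -- The opposite inequality holds at every vertex, which makes the averaged one tight at
          -- every vertex.
          escaping+dependent≤avoiding : ∀ v → #escaping ⊤ v + #dependent ⊤ v ≤ #avoiding ⊤ v
          escaping+dependent≤avoiding = sum-mono-tight
            (λ v → ≤-trans (avoiding≤escaping v) (m≤m+n _ _)) (averaging ⊤ 3≤t)

          no-dependent : ∀ v → #dependent ⊤ v ≤ 0
          no-dependent v = +-boundʳ
            (≤-trans (escaping+dependent≤avoiding v) (≤-reflexive (sym (+-identityʳ _))))
            (avoiding≤escaping v)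

          optimal-at : ∀ v → extremal t D n ≤ #indep (N v) + ∣ ⊤ ─ N v ∣ C t
          optimal-at v = ≤-trans (recursion v) (+-monoʳ-≤ (#indep (N v))
            (≤-trans (m≤m+n _ _) (≤-trans (escaping+dependent≤avoiding v) (≤-reflexive (#avoiding≡C ⊤ ∈⊤)))))

          sizes : ∀ v → (∣ N v ∣ ≡ D × ∣ ⊤ ─ N v ∣ ≡ δ) ⊎ (∣ N v ∣ ≡ δ × ∣ ⊤ ─ N v ∣ ≡ D)
          sizes v = extremal-step-tight 3≤t (codegree≤D v) (0<∣W─N∣ ∈⊤) t≤δ δ≤D (trans (∣p∣+∣⊤─p∣≡n (N v)) n≡D+δ)
            (≤-trans (≤-reflexive (cong (extremal t D) (∣p∣+∣⊤─p∣≡n (N v))))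
              (≤-trans (optimal-at v) (+-monoˡ-≤ _ (#indep≤extremal (N v)))))

          ∣N∣≤D : ∀ v → ∣ N v ∣ ≤ D
          ∣N∣≤D v with sizes v
          ... | inj₁ (∣N∣≡ , _) = ≤-reflexive ∣N∣≡
          ... | inj₂ (∣N∣≡ , _) = ≤-trans (≤-reflexive ∣N∣≡) δ≤D

          t≤∣N∣ : ∀ v → t ≤ ∣ N v ∣
          t≤∣N∣ v with sizes v
          ... | inj₁ (∣N∣≡ , _) = ≤-trans (≤-trans t≤δ δ≤D) (≤-reflexive (sym ∣N∣≡))
          ... | inj₂ (∣N∣≡ , _) = ≤-trans t≤δ (≤-reflexive (sym ∣N∣≡))

          t≤∣─N∣ : ∀ v → t ≤ ∣ ⊤ ─ N v ∣
          t≤∣─N∣ v with sizes v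
          ... | inj₁ (_ , ∣─N∣≡) = ≤-trans t≤δ (≤-reflexive (sym ∣─N∣≡))
          ... | inj₂ (_ , ∣─N∣≡) = ≤-trans (≤-trans t≤δ δ≤D) (≤-reflexive (sym ∣─N∣≡))

          -- Cancelling the common term leaves the extremal value at |N(v)|, which is a single
          -- binomial coefficient because |N(v)| ≤ D.
          N-full : ∀ v → ∣ N v ∣ C t ≤ #indep (N v)
          N-full v = ≤-trans (≤-reflexive (sym (extremal-low 3≤t (∣N∣≤D v))))
            (+-boundˡ (≤-trans (step v) (optimal-at v)) ≤-refl)

          N-independent : ∀ v → Independent (N v)
          N-independent v {x} {y} x∈ y∈
            with T , ⊆T , T⊆ , ∣T∣≡ ← between (⁅x⁆∪p⊆ x∈ (⁅x⁆⊆ y∈))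
              (≤-trans (∣⁅x⁆∪⁅y⁆∣≤2 x y) (≤-trans (n≤1+n 2) 3≤t)) (t≤∣N∣ v)
            = #indep-full (N-full v) ∣T∣≡ T⊆ (⊆T (x∈p∪q⁺ (inj₁ (x∈⁅x⁆ x)))) (⊆T (x∈p∪q⁺ (inj₂ (x∈⁅x⁆ y))))

          ─N-independent : ∀ v → Independent (⊤ ─ N v)
          ─N-independent v {x} {y} x∈ y∈
            -- T must contain v to count as a dependent set for v. Together with x and y this asks
            -- for three vertices, which fit because 3 ≤ t.
            with T , ⊆T , T⊆ , ∣T∣≡ ← between {S = ⁅ v ⁆ ∪ (⁅ x ⁆ ∪ ⁅ y ⁆)}
              (⁅x⁆∪p⊆ (v∈W─N ∈⊤) (⁅x⁆∪p⊆ x∈ (⁅x⁆⊆ y∈)))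
              (≤-trans (∣⁅x⁆∪p∣≤ v (⁅ x ⁆ ∪ ⁅ y ⁆)) (≤-trans (s≤s (∣⁅x⁆∪⁅y⁆∣≤2 x y)) 3≤t)) (t≤∣─N∣ v)
            with independent? T
          ... | yes ind = ind
            (⊆T (q⊆p∪q ⁅ v ⁆ _ (x∈p∪q⁺ (inj₁ (x∈⁅x⁆ x)))))
            (⊆T (q⊆p∪q ⁅ v ⁆ _ (x∈p∪q⁺ (inj₂ (x∈⁅x⁆ y)))))
          ... | no ¬ind = contradiction
            (⊆T (p⊆p∪q _ (x∈⁅x⁆ v)) , (∣T∣≡ , λ {z} → T⊆ {z}) , λ ind → ¬ind (λ {u} {w} → ind {u} {w}))
            (𝟙-zero (dependent? ⊤ v T) (∑-mono-tight (λ _ → z≤n) (≤-trans (no-dependent v) z≤n) T))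

          -- Otherwise v and y would both be non-neighbours of x, hence non-adjacent by independence
          -- of V ∖ N(x), contrary to y ∈ N(v).
          joined : ∀ {v x y} → x ∉ N v → y ∈ N v → y ∈ N x
          joined {v} {x} {y} x∉Nv y∈Nv with y ∈? N x
          ... | yes y∈Nx = y∈Nx
          ... | no y∉Nx = contradiction y∈Nv (─N-independent x
            (x∈p∧x∉q⇒x∈p─q ∈⊤ (x∉Nv ∘ N-sym)) (x∈p∧x∉q⇒x∈p─q ∈⊤ y∉Nx))

  -- Bipartitions, list counts and isomorphism.

  -- Each t-subset of either class is independent, and none is counted twice: a set inside both
  -- classes would be empty, against 0 < t.
  #indep-bipartition≥ : ∀ {t P} → 0 < t → Independent P → Independent (⊤ ─ P) →
    ∣ P ∣ C t + ∣ ⊤ ─ P ∣ C t ≤ #indep t ⊤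
  #indep-bipartition≥ {t} {P} 0<t indP ind─P = begin
    ∣ P ∣ C t + ∣ ⊤ ─ P ∣ C t
      ≡⟨ cong₂ _+_ (∑-subsets≡C P t) (∑-subsets≡C (⊤ ─ P) t) ⟨
    ∑ (λ S → 𝟙 (sized⊆? t P S)) + ∑ (λ S → 𝟙 (sized⊆? t (⊤ ─ P) S))
      ≡⟨ ∑-distrib (λ S → 𝟙 (sized⊆? t P S)) (λ S → 𝟙 (sized⊆? t (⊤ ─ P) S)) ⟨
    ∑ (λ S → 𝟙 (sized⊆? t P S) + 𝟙 (sized⊆? t (⊤ ─ P) S))
      ≤⟨ ∑-mono (λ S → 𝟙-disjoint (indep⊆? t ⊤ S) (sized⊆? t P S) (sized⊆? t (⊤ ─ P) S)
        (λ (e , s) → e , ⊆⊤ , λ x∈ y∈ → indP (s x∈) (s y∈))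
        (λ (e , s) → e , ⊆⊤ , λ x∈ y∈ → ind─P (s x∈) (s y∈))
        (λ (e , s) (_ , s′) → disjoint S e s s′)) ⟩
    #indep t ⊤ ∎
    where
    open ≤-Reasoning
    disjoint : ∀ S → ∣ S ∣ ≡ t → S ⊆ P → S ⊆ ⊤ ─ P → ⊥
    disjoint S e s s′ with x , x∈S ← ∣p∣>0⇒Nonempty S (≤-trans 0<t (≤-reflexive (sym e))) =
      x∈p─q⇒x∉q ⊤ P (s′ x∈S) (s x∈S)

  degree≡∣N∣ : ∀ v → degree G v ≡ ∣ N v ∣
  degree≡∣N∣ v = countᵇ-tabulate (adj G v) (λ u → u)

  indepCount≡#indep : ∀ t → indepCount t G ≡ #indep t ⊤
  indepCount≡#indep t = trans (countᵇ-allSubsets n _) (∑-cong λ S →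
    𝟙-cong (_ Bool.≟ true) (indep⊆? t ⊤ S) (to S) (λ (e , _ , i) → from S e i))
    where
    to : ∀ S → isIndependentᵇ G S ∧ (∣ S ∣ ≡ᵇ t) ≡ true → ∣ S ∣ ≡ t × S ⊆ ⊤ × Independent S
    to S eq with isIndependentᵇ G S in ind | ∣ S ∣ ≡ᵇ t in size
    ... | true | true = ≡ᵇ⇒≡ ∣ S ∣ t (subst T (sym size) _) , ⊆⊤ , isIndependentᵇ-sound S ind
    from : ∀ S → ∣ S ∣ ≡ t → Independent S → isIndependentᵇ G S ∧ (∣ S ∣ ≡ᵇ t) ≡ true
    from S e i = cong₂ _∧_ (isIndependentᵇ-complete S i) (Bool.T-≡ .Equivalence.to (≡⇒≡ᵇ ∣ S ∣ t e))

  -- Both adjacencies are the exclusive or of the sides of the endpoints, and the permutation from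
  -- `separating` carries one notion of side to the other.
  bipartite⇒≅ : ∀ P → Independent P → (∀ {x y} → x ∉ P → y ∉ P → y ∉ N x) →
    (∀ {x y} → x ∉ P → y ∈ P → y ∈ N x) → G ≅ completeBipartite n ∣ P ∣
  bipartite⇒≅ P indP ind∁P join with π , side ← separating P = record
    { f = π ⟨$⟩ʳ_
    ; g = π ⟨$⟩ˡ_
    ; fg = λ _ → inverseʳ π
    ; gf = λ _ → inverseˡ π
    ; preserves = λ u v → trans (completeBipartite-adj ∣ P ∣ (π ⟨$⟩ʳ u) (π ⟨$⟩ʳ v))
        (trans (cong₂ _xor_ (side u) (side v)) (sym (adj≡xor u v)))
    }
    where
    ∉⇒lookup : ∀ {x} → x ∉ P → lookup P x ≡ false
    ∉⇒lookup {x} x∉P = Bool.¬-not (x∉P ∘ lookup⇒[]= x P)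
    ∉N⇒adj : ∀ {u v} → v ∉ N u → adj G u v ≡ false
    ∉N⇒adj v∉N = Bool.¬-not (v∉N ∘ adj⇒∈N)
    adj≡xor : ∀ u v → adj G u v ≡ lookup P u xor lookup P v
    adj≡xor u v with u ∈? P | v ∈? P
    ... | yes u∈P | yes v∈P = trans (∉N⇒adj (indP u∈P v∈P)) (sym (cong₂ _xor_ ([]=⇒lookup u∈P) ([]=⇒lookup v∈P)))
    ... | yes u∈P | no v∉P = trans (∈N⇒adj (N-sym (join v∉P u∈P))) (sym (cong₂ _xor_ ([]=⇒lookup u∈P) (∉⇒lookup v∉P)))
    ... | no u∉P | yes v∈P = trans (∈N⇒adj (join u∉P v∈P)) (sym (cong₂ _xor_ (∉⇒lookup u∉P) ([]=⇒lookup v∈P)))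
    ... | no u∉P | no v∉P = trans (∉N⇒adj (ind∁P u∉P v∉P)) (sym (cong₂ _xor_ (∉⇒lookup u∉P) (∉⇒lookup v∉P)))

-- Independent sets of the complete bipartite graph.

firstVertices : ∀ n → ℕ → Subset n
firstVertices n δ = tabulate (λ v → toℕ v <ᵇ δ)

∣firstVertices∣≡δ : ∀ {n δ} → δ ≤ n → ∣ firstVertices n δ ∣ ≡ δ
∣firstVertices∣≡δ {zero} z≤n = refl
∣firstVertices∣≡δ {suc n} {zero} z≤n = ∣firstVertices∣≡δ {n} z≤n
∣firstVertices∣≡δ {suc n} {suc δ} (s≤s δ≤n) = cong suc (∣firstVertices∣≡δ δ≤n)

firstVertices-same-side : ∀ {n} δ {u v : Fin n} →
  (toℕ u <ᵇ δ) ≡ (toℕ v <ᵇ δ) → v ∉ N (completeBipartite n δ) u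
firstVertices-same-side {n} δ {u} {v} eq v∈N
  with () ← trans (sym (∈N⇒adj (completeBipartite n δ) v∈N))
  (trans (completeBipartite-adj δ u v) (trans (cong (_xor (toℕ v <ᵇ δ)) eq) (Bool.xor-same (toℕ v <ᵇ δ))))

-- A lower bound is the direction required: it places `extremal` below this graph's count, and a
-- graph G with the same count then attains `extremal`.
completeBipartite≥ : ∀ {n δ t} → δ ≤ n → 0 < t →
  δ C t + (n ∸ δ) C t ≤ #indep (completeBipartite n δ) t ⊤
completeBipartite≥ {n} {δ} {t} δ≤n 0<t = begin
  δ C t + (n ∸ δ) C t
    ≡⟨ cong₂ (λ x y → x C t + y C t) (sym ∣A∣≡δ) (sym ∣─A∣≡) ⟩
  ∣ A ∣ C t + ∣ ⊤ ─ A ∣ C t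
    ≤⟨ #indep-bipartition≥ (completeBipartite n δ) 0<t
      (λ u∈ v∈ → firstVertices-same-side δ (trans (inP u∈) (sym (inP v∈))))
      (λ u∈ v∈ → firstVertices-same-side δ (trans (outP u∈) (sym (outP v∈)))) ⟩
  #indep (completeBipartite n δ) t ⊤ ∎
  where
  open ≤-Reasoning
  A = firstVertices n δ
  ∣A∣≡δ : ∣ A ∣ ≡ δ
  ∣A∣≡δ = ∣firstVertices∣≡δ δ≤n
  ∣─A∣≡ : ∣ ⊤ ─ A ∣ ≡ n ∸ δ
  ∣─A∣≡ = +-cancelˡ-≡ δ _ _ (trans (cong (_+ ∣ ⊤ ─ A ∣) (sym ∣A∣≡δ))
    (trans (∣p∣+∣⊤─p∣≡n A) (sym (m+[n∸m]≡n δ≤n))))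
  inP : ∀ {u} → u ∈ A → (toℕ u <ᵇ δ) ≡ true
  inP {u} u∈A = trans (sym (lookup∘tabulate _ u)) ([]=⇒lookup u∈A)
  outP : ∀ {u} → u ∈ ⊤ ─ A → (toℕ u <ᵇ δ) ≡ false
  outP {u} u∈ = Bool.¬-not λ eq → x∈p─q⇒x∉q ⊤ A u∈ (lookup⇒[]= u A (trans (lookup∘tabulate _ u) eq))

-- The bound and the uniqueness for minimum degree δ.

theorem1p2 : (n δ : ℕ) → 2 * δ ≤ n → (t : ℕ) → 3 ≤ t →
    ((G : Graph n) → MinDegreeAtLeast G δ →
    indepCount t G ≤ indepCount t (completeBipartite n δ))
    × (t ≤ δ → (G : Graph n) → MinDegreeAtLeast G δ →
    indepCount t G ≡ indepCount t (completeBipartite n δ) →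
    G ≅ completeBipartite n δ)
theorem1p2 n δ 2δ≤n t 3≤t = upper , unique
  where
  D = n ∸ δ

  δ+δ≤n : δ + δ ≤ n
  δ+δ≤n = ≤-trans (≤-reflexive (cong (δ +_) (sym (+-identityʳ δ)))) 2δ≤n

  δ≤n : δ ≤ n
  δ≤n = ≤-trans (m≤m+n δ δ) δ+δ≤n

  δ≤D : δ ≤ D
  δ≤D = ≤-trans (≤-reflexive (sym (m+n∸n≡m δ δ))) (∸-monoˡ-≤ δ δ+δ≤n)

  n≡D+δ : n ≡ D + δ
  n≡D+δ = sym (m∸n+n≡m δ≤n)

  extremal≤ : extremal t D n ≤ indepCount t (completeBipartite n δ)
  extremal≤ = begin
    extremal t D n ≡⟨ cong (extremal t D) n≡D+δ ⟩
    extremal t D (D + δ) ≡⟨ extremal-high 3≤t D δ ⟩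
    D C t + δ C t ≡⟨ +-comm (D C t) (δ C t) ⟩
    δ C t + D C t ≤⟨ completeBipartite≥ δ≤n (≤-trans (s≤s z≤n) 3≤t) ⟩
    #indep (completeBipartite n δ) t ⊤ ≡⟨ indepCount≡#indep (completeBipartite n δ) t ⟨
    indepCount t (completeBipartite n δ) ∎
    where open ≤-Reasoning

  codegree≤D : ∀ G → MinDegreeAtLeast G δ → ∀ v → ∣ ⊤ ─ N G v ∣ ≤ D
  codegree≤D G mindeg v = begin
    ∣ ⊤ ─ N G v ∣ ≡⟨ m+n∸m≡n ∣ N G v ∣ _ ⟨
    ∣ N G v ∣ + ∣ ⊤ ─ N G v ∣ ∸ ∣ N G v ∣ ≡⟨ cong (_∸ ∣ N G v ∣) (∣p∣+∣⊤─p∣≡n (N G v)) ⟩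
    n ∸ ∣ N G v ∣ ≤⟨ ∸-monoʳ-≤ n (≤-trans (mindeg v) (≤-reflexive (degree≡∣N∣ G v))) ⟩
    D ∎
    where open ≤-Reasoning

  upper : ∀ G → MinDegreeAtLeast G δ → indepCount t G ≤ indepCount t (completeBipartite n δ)
  upper G mindeg = begin
    indepCount t G ≡⟨ indepCount≡#indep G t ⟩
    #indep G t ⊤ ≤⟨ #indep≤extremal G t 3≤t D (codegree≤D G mindeg) ⊤ ⟩
    extremal t D ∣ ⊤ {n} ∣ ≡⟨ cong (extremal t D) (∣⊤∣≡n n) ⟩
    extremal t D n ≤⟨ extremal≤ ⟩
    indepCount t (completeBipartite n δ) ∎
    where open ≤-Reasoning

  unique : t ≤ δ → ∀ G → MinDegreeAtLeast G δ →
    indepCount t G ≡ indepCount t (completeBipartite n δ) → G ≅ completeBipartite n δ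
  unique t≤δ G mindeg eq = case sizes v of λ where
      -- The class of size δ has to play the role of P, since `completeBipartite` puts δ vertices on
      -- its first side. Here it is V ∖ N(v); in the other case it is N(v).
      (inj₁ (_ , m≡δ)) → subst (λ k → G ≅ completeBipartite n k) m≡δ
        (bipartite⇒≅ G (⊤ ─ N G v) (─N-independent v)
          (λ x∉ y∉ → N-independent v (∉─⇒∈ x∉) (∉─⇒∈ y∉))
          (λ x∉ y∈ → N-sym G (joined (x∈p─q⇒x∉q ⊤ (N G v) y∈) (∉─⇒∈ x∉))))
      (inj₂ (r≡δ , _)) → subst (λ k → G ≅ completeBipartite n k) r≡δ
        (bipartite⇒≅ G (N G v) (N-independent v)
          (λ x∉ y∉ → ─N-independent v (x∈p∧x∉q⇒x∈p─q ∈⊤ x∉) (x∈p∧x∉q⇒x∈p─q ∈⊤ y∉))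
          joined)
    where
    open Optimal G t 3≤t D (codegree≤D G mindeg) t≤δ δ≤D n≡D+δ
      (≤-trans extremal≤ (≤-reflexive (trans (sym eq) (indepCount≡#indep G t))))
    v : Fin n
    -- Any vertex serves; one exists because 3 ≤ t ≤ δ ≤ n.
    v = Fin.fromℕ< (≤-trans (≤-trans (≤-trans (s≤s z≤n) 3≤t) t≤δ) δ≤n)
    ∉─⇒∈ : ∀ {x} → x ∉ ⊤ ─ N G v → x ∈ N G v
    ∉─⇒∈ {x} x∉ with x ∈? N G v
    ... | yes x∈N = x∈N
    ... | no x∉N = contradiction (x∈p∧x∉q⇒x∈p─q ∈⊤ x∉N) x∉
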